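{- Let $V$ be a fixed finite set of INF sentences over a vocabulary $\Sigma$ and let $O(V)=\{O_\varphi\mid\varphi\in V\}$. Then for every finite four-valued $\Sigma$-structure $\tilde I$, $\lim_{O(V)}(\tilde I)$ is computable in time polynomial in $|\tilde I|$.
   Context: Vocabularies are finite sets of predicate symbols (equality interpreted as identity). Truth values $\mathbf{t},\mathbf{f},\mathbf{u},\mathbf{i}$; inverse swaps $\mathbf{t},\mathbf{f}$ and fixes $\mathbf{u},\mathbf{i}$. Truth order $\le_t$: $\mathbf{f}\le_t\mathbf{u}\le_t\mathbf{t}$, $\mathbf{f}\le_t\mathbf{i}\le_t\mathbf{t}$. Precision order $\le_p$: $\mathbf{u}\le_p\mathbf{t}\le_p\mathbf{i}$, $\mathbf{u}\le_p\mathbf{f}\le_p\mathbf{i}$. A four-valued $\Sigma$-structure $\tilde I$ has domain $D$ and assigns each $P/n\in\Sigma$ a function $P^{\tilde I}:D^n\to\{\mathbf{t},\mathbf{f},\mathbf{u},\mathbf{i}\}$; $|\tilde I|$ is $|D|$; two-valued structures are identified with ordinary structures. $\le_p$ on structures is pointwise. Formula values $\tilde I\theta(\varphi)$: atoms by $P^{\tilde I}$, $\neg$ by inverse, $\wedge,\forall$ by $\le_t$-glb, $\vee,\exists$ by $\le_t$-lub. An INF sentence is $\forall\overline{x}(\psi\supset L[\overline{x}])$ with $\psi$ having free variables among $\overline{x}$ and $L$ one of $P(\overline{x}),\neg P(\overline{x})$. Its INF propagator $O_\varphi$: $O_\varphi(\tilde I)$ agrees with $\tilde I$ except that for each $\overline{d}$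 with $\tilde I[\overline{x}/\overline{d}](\psi)\ge_p\mathbf{t}$, $P^{O_\varphi(\tilde I)}(\overline{d})=\mathrm{lub}_{\le_p}\{\mathbf{t},P^{\tilde I}(\overline{d})\}$ (resp. $\mathrm{lub}_{\le_p}\{\mathbf{f},P^{\tilde I}(\overline{d})\}$ if $L$ is negative). For a set $W$ of such operators, a $W$-refinement sequence from $\tilde I$ is a (possibly transfinite) sequence $\langle\tilde J_\xi\rangle_{0\le\xi\le\alpha}$ with $\tilde J_0=\tilde I$, $\tilde J_{\xi+1}=O(\tilde J_\xi)$ for some $O\in W$, $\tilde J_\xi<_p\tilde J_{\xi+1}$, and $\tilde J_\lambda=\mathrm{lub}_{\le_p}\{\tilde J_\xi\mid\xi<\lambda\}$ for limit $\lambda$; it is stabilizing if it cannot be extended, i.e. $O(\tilde J_\alpha)=\tilde J_\alpha$ for all $O\in W$. The operators $O_\varphi$ are monotone and inflationary, and all stabilizing $W$-refinement sequences from $\tilde I$ have the same last element, denoted $\lim_W(\tilde I)$. -}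

module Defs where

open import Level using (Level; 0ℓ) renaming (suc to lsuc)
open import Data.Nat.Base using (ℕ; zero; suc; _+_; _*_; _≤_)
open import Data.Fin.Base using (Fin)
import Data.Fin.Properties as Fin
open import Data.Vec.Base as Vec using (Vec; []; _∷_)
open import Data.List.Base as List
  using (List; []; _∷_; _++_; allFin; concatMap; cartesianProductWith; foldr; replicate)
open import Data.List.Relation.Unary.Any using (Any)
open import Data.Maybe.Base as Maybe using (Maybe; just; nothing)
open import Data.Product.Base using (∃; ∃₂; _×_; _,_)
open import Data.Sign.Base using (Sign)
open import Data.Sum.Base using (_⊎_; inj₁)
open import Function.Bundles using (_↔_)
open import Induction.WellFounded using (WellFounded)
open import Relation.Binary.Core using (Rel)
open import Relation.Binary.Definitions using (Decidable)
open import Relation.Binary.Lattice.Definitions using (Infimum; Supremum)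
open import Relation.Binary.PropositionalEquality.Core using (_≡_; refl)
open import Relation.Binary.Structures using (IsStrictTotalOrder)
open import Relation.Nullary using (¬_; yes; no)
open import Relation.Unary using (Pred)

------------------------------------------------------------------------
-- Truth values

data Four : Set where
  𝐭 𝐟 𝐮 𝐢 : Four

inverse : Four → Four
inverse 𝐭 = 𝐟
inverse 𝐟 = 𝐭
inverse 𝐮 = 𝐮
inverse 𝐢 = 𝐢

infix 4 _≤t_ _≤p_ _≤p?_

data _≤t_ : Rel Four 0ℓ where
  𝐟≤    : ∀ {x} → 𝐟 ≤t x
  ≤𝐭    : ∀ {x} → x ≤t 𝐭
  reflₜ : ∀ {x} → x ≤t x

data _≤p_ : Rel Four 0ℓ where
  𝐮≤    : ∀ {x} → 𝐮 ≤p x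
  ≤𝐢    : ∀ {x} → x ≤p 𝐢
  reflₚ : ∀ {x} → x ≤p x

_≤p?_ : Decidable _≤p_
𝐮 ≤p? y = yes 𝐮≤
𝐭 ≤p? 𝐭 = yes reflₚ
𝐭 ≤p? 𝐟 = no λ ()
𝐭 ≤p? 𝐮 = no λ ()
𝐭 ≤p? 𝐢 = yes ≤𝐢
𝐟 ≤p? 𝐭 = no λ ()
𝐟 ≤p? 𝐟 = yes reflₚ
𝐟 ≤p? 𝐮 = no λ ()
𝐟 ≤p? 𝐢 = yes ≤𝐢
𝐢 ≤p? 𝐭 = no λ ()
𝐢 ≤p? 𝐟 = no λ ()
𝐢 ≤p? 𝐮 = no λ ()
𝐢 ≤p? 𝐢 = yes reflₚ

infixr 7 _∧t_
infixr 6 _∨t_ _⊔p_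

_∧t_ : Four → Four → Four
𝐭 ∧t y = y
𝐟 ∧t y = 𝐟
𝐮 ∧t 𝐭 = 𝐮
𝐮 ∧t 𝐟 = 𝐟
𝐮 ∧t 𝐮 = 𝐮
𝐮 ∧t 𝐢 = 𝐟
𝐢 ∧t 𝐭 = 𝐢
𝐢 ∧t 𝐟 = 𝐟
𝐢 ∧t 𝐮 = 𝐟
𝐢 ∧t 𝐢 = 𝐢

_∨t_ : Four → Four → Four
𝐭 ∨t y = 𝐭
𝐟 ∨t y = y
𝐮 ∨t 𝐭 = 𝐭
𝐮 ∨t 𝐟 = 𝐮
𝐮 ∨t 𝐮 = 𝐮
𝐮 ∨t 𝐢 = 𝐭
𝐢 ∨t 𝐭 = 𝐭
𝐢 ∨t 𝐟 = 𝐢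
𝐢 ∨t 𝐮 = 𝐭
𝐢 ∨t 𝐢 = 𝐢

_⊔p_ : Four → Four → Four
𝐮 ⊔p y = y
𝐢 ⊔p y = 𝐢
𝐭 ⊔p 𝐭 = 𝐭
𝐭 ⊔p 𝐟 = 𝐢
𝐭 ⊔p 𝐮 = 𝐭
𝐭 ⊔p 𝐢 = 𝐢
𝐟 ⊔p 𝐭 = 𝐢
𝐟 ⊔p 𝐟 = 𝐟
𝐟 ⊔p 𝐮 = 𝐟
𝐟 ⊔p 𝐢 = 𝐢

∧t-infimum : Infimum _≤t_ _∧t_
∧t-infimum 𝐭 y = ≤𝐭 , reflₜ , λ _ _ q → q
∧t-infimum 𝐟 y = reflₜ , 𝐟≤ , λ _ p _ → p
∧t-infimum 𝐮 𝐭 = reflₜ , ≤𝐭 , λ _ p _ → p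
∧t-infimum 𝐮 𝐟 = 𝐟≤ , reflₜ , λ _ _ q → q
∧t-infimum 𝐮 𝐮 = reflₜ , reflₜ , λ _ p _ → p
∧t-infimum 𝐮 𝐢 = 𝐟≤ , 𝐟≤ , λ { _ 𝐟≤ _ → 𝐟≤ ; _ reflₜ () }
∧t-infimum 𝐢 𝐭 = reflₜ , ≤𝐭 , λ _ p _ → p
∧t-infimum 𝐢 𝐟 = 𝐟≤ , reflₜ , λ _ _ q → q
∧t-infimum 𝐢 𝐮 = 𝐟≤ , 𝐟≤ , λ { _ 𝐟≤ _ → 𝐟≤ ; _ reflₜ () }
∧t-infimum 𝐢 𝐢 = reflₜ , reflₜ , λ _ p _ → p

∨t-supremum : Supremum _≤t_ _∨t_
∨t-supremum 𝐭 y = reflₜ , ≤𝐭 , λ _ p _ → p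
∨t-supremum 𝐟 y = 𝐟≤ , reflₜ , λ _ _ q → q
∨t-supremum 𝐮 𝐭 = ≤𝐭 , reflₜ , λ _ _ q → q
∨t-supremum 𝐮 𝐟 = reflₜ , 𝐟≤ , λ _ p _ → p
∨t-supremum 𝐮 𝐮 = reflₜ , reflₜ , λ _ p _ → p
∨t-supremum 𝐮 𝐢 = ≤𝐭 , ≤𝐭 , λ { _ ≤𝐭 _ → ≤𝐭 ; _ reflₜ () }
∨t-supremum 𝐢 𝐭 = ≤𝐭 , reflₜ , λ _ _ q → q
∨t-supremum 𝐢 𝐟 = reflₜ , 𝐟≤ , λ _ p _ → p
∨t-supremum 𝐢 𝐮 = ≤𝐭 , ≤𝐭 , λ { _ ≤𝐭 _ → ≤𝐭 ; _ reflₜ () }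
∨t-supremum 𝐢 𝐢 = reflₜ , reflₜ , λ _ p _ → p

⊔p-supremum : Supremum _≤p_ _⊔p_
⊔p-supremum 𝐮 y = 𝐮≤ , reflₚ , λ _ _ q → q
⊔p-supremum 𝐢 y = reflₚ , ≤𝐢 , λ _ p _ → p
⊔p-supremum 𝐭 𝐭 = reflₚ , reflₚ , λ _ p _ → p
⊔p-supremum 𝐭 𝐟 = ≤𝐢 , ≤𝐢 , λ { _ ≤𝐢 _ → ≤𝐢 ; _ reflₚ () }
⊔p-supremum 𝐭 𝐮 = reflₚ , 𝐮≤ , λ _ p _ → p
⊔p-supremum 𝐭 𝐢 = ≤𝐢 , reflₚ , λ _ _ q → q
⊔p-supremum 𝐟 𝐭 = ≤𝐢 , ≤𝐢 , λ { _ ≤𝐢 _ → ≤𝐢 ; _ reflₚ () }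
⊔p-supremum 𝐟 𝐟 = reflₚ , reflₚ , λ _ p _ → p
⊔p-supremum 𝐟 𝐮 = reflₚ , 𝐮≤ , λ _ p _ → p
⊔p-supremum 𝐟 𝐢 = ≤𝐢 , reflₚ , λ _ _ q → q

-- Bounds of finite families; 𝐭 and 𝐟 are the bounds of the empty family.
⋀ ⋁ : List Four → Four
⋀ = foldr _∧t_ 𝐭
⋁ = foldr _∨t_ 𝐟

------------------------------------------------------------------------
-- Vocabularies and four-valued structures

record Vocabulary : Set where
  field
    size  : ℕ
    arity : Fin size → ℕ

  Symbol : Set
  Symbol = Fin size

open Vocabulary using (Symbol; arity)

-- A finite domain with n elements is taken to be Fin n (possibly empty), so
-- that |I| = n.
Structure : Vocabulary → ℕ → Set
Structure σ n = (P : Symbol σ) → Vec (Fin n) (arity σ P) → Four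

module _ {σ : Vocabulary} {n : ℕ} where

  infix 4 _≈ˢ_ _≤ˢ_ _<ˢ_

  -- Equality of structures; function extensionality is not available.
  _≈ˢ_ : Rel (Structure σ n) 0ℓ
  I ≈ˢ J = ∀ P ds → I P ds ≡ J P ds

  _≤ˢ_ : Rel (Structure σ n) 0ℓ
  I ≤ˢ J = ∀ P ds → I P ds ≤p J P ds

  _<ˢ_ : Rel (Structure σ n) 0ℓ
  I <ˢ J = I ≤ˢ J × ¬ (I ≈ˢ J)

------------------------------------------------------------------------
-- First-order formulas and their values

-- Formula σ m: free variables among m variables, de Bruijn style; a
-- quantifier binds variable zero of its body.
data Formula (σ : Vocabulary) (m : ℕ) : Set where
  atom      : (P : Symbol σ) → Vec (Fin m) (arity σ P) → Formula σ m
  _≐_       : Fin m → Fin m → Formula σ m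
  not       : Formula σ m → Formula σ m
  _and_     : Formula σ m → Formula σ m → Formula σ m
  _or_      : Formula σ m → Formula σ m → Formula σ m
  all′ ex′  : Formula σ (suc m) → Formula σ m

eval : ∀ {σ n m} → Structure σ n → Vec (Fin n) m → Formula σ m → Four
eval I θ (atom P xs) = I P (Vec.map (Vec.lookup θ) xs)
eval I θ (x ≐ y) with Vec.lookup θ x Fin.≟ Vec.lookup θ y
... | yes _ = 𝐭
... | no  _ = 𝐟
eval I θ (not φ)     = inverse (eval I θ φ)
eval I θ (φ and ψ)   = eval I θ φ ∧t eval I θ ψ
eval I θ (φ or ψ)    = eval I θ φ ∨t eval I θ ψ
eval {n = n} I θ (all′ φ) = ⋀ (List.map (λ d → eval I (d ∷ θ) φ) (allFin n))
eval {n = n} I θ (ex′ φ)  = ⋁ (List.map (λ d → eval I (d ∷ θ) φ) (allFin n))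

------------------------------------------------------------------------
-- INF sentences and their propagators

-- The sentence ∀ x̄ (body ⊃ L[x̄]), where L[x̄] is head(x̄) for sign + and
-- ¬ head(x̄) for sign -; variable i of body is the i-th variable of x̄.
record INF (σ : Vocabulary) : Set where
  constructor inf
  field
    head : Symbol σ
    sign : Sign
    body : Formula σ (arity σ head)

literalValue : Sign → Four
literalValue Sign.+ = 𝐭
literalValue Sign.- = 𝐟

Operator : Vocabulary → ℕ → Set
Operator σ n = Structure σ n → Structure σ n

propagator : ∀ {σ n} → INF σ → Operator σ n
propagator (inf P s ψ) I Q ds with P Fin.≟ Q
... | no  _    = I Q ds
... | yes refl with 𝐭 ≤p? eval I ds ψ
...   | yes _ = literalValue s ⊔p I P ds
...   | no  _ = I P ds

propagators : ∀ {σ n} → List (INF σ) → Pred (Operator σ n) 0ℓ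
propagators V O = Any (λ φ → O ≡ propagator φ) V

------------------------------------------------------------------------
-- Transfinite refinement sequences

-- The set of ordinals {ξ | 0 ≤ ξ ≤ α}: a well-ordered type with a greatest
-- element.  That every element is zero, a successor or a limit holds
-- classically for any well-order; constructively it is required explicitly.
record SuccessorOrdinal : Set₁ where
  infix 4 _<_
  field
    Index              : Set
    _<_                : Rel Index 0ℓ
    isStrictTotalOrder : IsStrictTotalOrder _≡_ _<_
    wellFounded        : WellFounded _<_

  IsZero : Pred Index 0ℓ
  IsZero ξ = ∀ η → ¬ (η < ξ)

  IsSuccessorOf : Rel Index 0ℓ
  IsSuccessorOf ξ η = η < ξ × (∀ ζ → η < ζ → ¬ (ζ < ξ))

  IsLimit : Pred Index 0ℓ
  IsLimit ξ = (∃ λ η → η < ξ) × (∀ η → η < ξ → ∃ λ ζ → η < ζ × ζ < ξ)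

  field
    classify : ∀ ξ → IsZero ξ ⊎ (∃ λ η → IsSuccessorOf ξ η) ⊎ IsLimit ξ
    top      : Index
    top-max  : ∀ ξ → ¬ (top < ξ)

module _ {σ : Vocabulary} {n : ℕ} where

  record RefinementSequence
    (W : Pred (Operator σ n) 0ℓ) (I : Structure σ n) : Set₁ where
    field
      ordinal : SuccessorOrdinal
    open SuccessorOrdinal ordinal public
    field
      J         : Index → Structure σ n
      initial   : ∀ ξ → IsZero ξ → J ξ ≈ˢ I
      step      : ∀ ξ η → IsSuccessorOf ξ η → ∃ λ O → W O × J ξ ≈ˢ O (J η)
      increase  : ∀ ξ η → IsSuccessorOf ξ η → J η <ˢ J ξ
      lub-upper : ∀ ξ → IsLimit ξ → ∀ η → η < ξ → J η ≤ˢ J ξ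
      lub-least : ∀ ξ → IsLimit ξ → ∀ K → (∀ η → η < ξ → J η ≤ˢ K) → J ξ ≤ˢ K

    last : Structure σ n
    last = J top

    Stabilizing : Set
    Stabilizing = ∀ O → W O → O last ≈ˢ last

  open RefinementSequence using (last; Stabilizing)

  -- L is lim_W(I): the common last element of all stabilizing W-refinement
  -- sequences from I, of which there is at least one.
  record IsLim (W : Pred (Operator σ n) 0ℓ) (I L : Structure σ n) : Set₁ where
    field
      exists : ∃ λ (S : RefinementSequence W I) → Stabilizing S × last S ≈ˢ L
      unique : (S : RefinementSequence W I) → Stabilizing S → last S ≈ˢ L

------------------------------------------------------------------------
-- Deterministic multi-tape Turing machines

Finite : Set → Set
Finite A = ∃ λ k → A ↔ Fin k

data Move : Set where
  goLeft stay goRight : Move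

-- A tape infinite in both directions: `left` lists the cells to the left of
-- the scanned one, nearest first; cells outside the two lists are blank.
record Tape (Γ : Set) : Set where
  constructor tape
  field
    left    : List (Maybe Γ)
    scanned : Maybe Γ
    right   : List (Maybe Γ)

open Tape using (scanned; right)

module _ {Γ : Set} where

  blankTape : Tape Γ
  blankTape = tape [] nothing []

  write : Maybe Γ → Tape Γ → Tape Γ
  write a (tape ls _ rs) = tape ls a rs

  move : Move → Tape Γ → Tape Γ
  move stay    t                    = t
  move goLeft  (tape []       a rs) = tape [] nothing (a ∷ rs)
  move goLeft  (tape (l ∷ ls) a rs) = tape ls l (a ∷ rs)
  move goRight (tape ls a [])       = tape (a ∷ ls) nothing []
  move goRight (tape ls a (r ∷ rs)) = tape (a ∷ ls) r rs

-- A machine with input/output alphabet A.  Cells contain a letter of A, an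
-- auxiliary symbol, or a blank (nothing).  The transition function returns
-- nothing when the machine halts.
record TuringMachine (A : Set) : Set₁ where
  field
    State       : Set
    stateFinite : Finite State
    Aux         : Set
    auxFinite   : Finite Aux
    workTapes   : ℕ
    start       : State

  Cell : Set
  Cell = Maybe (A ⊎ Aux)

  tapes : ℕ
  tapes = suc workTapes

  field
    δ : State → Vec Cell tapes → Maybe (State × Vec (Cell × Move) tapes)

module Run {A : Set} (M : TuringMachine A) where
  open TuringMachine M

  Config : Set
  Config = State × Vec (Tape (A ⊎ Aux)) tapes

  act : Cell × Move → Tape (A ⊎ Aux) → Tape (A ⊎ Aux)
  act (a , m) t = move m (write a t)

  next : Config → Maybe Config
  next (q , ts) =
    Maybe.map (λ (q′ , as) → q′ , Vec.zipWith act as ts) (δ q (Vec.map scanned ts))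

  inputTape : List A → Tape (A ⊎ Aux)
  inputTape []      = blankTape
  inputTape (a ∷ w) = tape [] (just (inj₁ a)) (List.map (λ b → just (inj₁ b)) w)

  initial : List A → Config
  initial w = start , inputTape w ∷ Vec.replicate workTapes blankTape

  -- The longest word over A at the beginning of a sequence of cells.
  word : List Cell → List A
  word (just (inj₁ a) ∷ cs) = a ∷ word cs
  word _                    = []

  -- The output is the word starting at the head of the first tape.
  output : Config → List A
  output (_ , t ∷ _) = word (scanned t ∷ right t)

  data _HaltsAfter_In_ : Config → ℕ → Config → Set where
    halt : ∀ {c} → next c ≡ nothing → c HaltsAfter 0 In c
    run  : ∀ {c c′ d k} → next c ≡ just c′ → c′ HaltsAfter k In d →
           c HaltsAfter suc k In d

  ComputesWithin : ℕ → List A → List A → Set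
  ComputesWithin b v w =
    ∃₂ λ k d → initial v HaltsAfter k In d × output d ≡ w × k ≤ b

-- Polynomials with natural coefficients, constant term first.
Polynomial : Set
Polynomial = List ℕ

evalPoly : Polynomial → ℕ → ℕ
evalPoly p x = foldr (λ a r → a + x * r) 0 p

------------------------------------------------------------------------
-- Polynomial-time computability on finite structures

data Letter : Set where
  stroke separator : Letter
  value            : Four → Letter

-- All tuples over the domain, in lexicographic order.
tuples : ∀ n k → List (Vec (Fin n) k)
tuples n zero    = [] ∷ []
tuples n (suc k) = cartesianProductWith _∷_ (allFin n) (tuples n k)

-- The domain size in unary, followed by the value table of each predicate.
encode : ∀ {σ n} → Structure σ n → List Letter
encode {σ} {n} I = replicate n stroke ++ concatMap table (allFin _)
  where
  table : Symbol σ → List Letter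
  table P = separator ∷ List.map (λ ds → value (I P ds)) (tuples n (arity σ P))

-- R is the graph of the function to be computed.  The machine and the
-- polynomial are uniform in the domain size n, which is also the quantity in
-- which the running time is polynomial (not the length of the encoding).
PolynomialTimeComputable : ∀ {ℓ : Level} (σ : Vocabulary) →
  (∀ {n} → Structure σ n → Structure σ n → Set ℓ) → Set (lsuc 0ℓ Level.⊔ ℓ)
PolynomialTimeComputable σ R =
  ∃₂ λ (M : TuringMachine Letter) (p : Polynomial) →
    ∀ {n} (I : Structure σ n) → ∃ λ J →
      R I J × Run.ComputesWithin M (evalPoly p n) (encode I) (encode J)

-- The limit is the least structure above I that is closed under all propagators of V:
-- by monotonicity a refinement sequence stays below every closed structure above I, and
-- a stabilizing one ends in a closed structure.  Hence it may be computed by any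
-- inflationary process that stays below the propagators, and the machine raises single
-- table entries in place.  Each change brings an entry closer to 𝐢, so there are at most
-- two changes per entry, and polynomially many sweeps over all sentences and all tuples
-- suffice.  During a sweep the value of a variable is a marked cell among n cells of its
-- own tape; quantifiers are loops that move the marker, and the head finds the entry of
-- a tuple (d₁, …, dₖ) by making dᵢ times the n^(k - i) moves of a nested loop, for each i.

module Submission where

open import Defs
open import Data.Bool.Base using (Bool; _∨_; false; if_then_else_; true) renaming (not to notᵇ)
open import Data.Empty using (⊥; ⊥-elim)
open import Data.Fin.Base as Fin using (Fin; inject₁; toℕ)
import Data.Fin.Induction as Fin
import Data.Fin.Properties as Fin
open import Data.List.Base as List
  using (List; []; _++_; _ʳ++_; _∷_; allFin; cartesianProductWith; concatMap; drop; foldr;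
    length; map; replicate; reverse; tabulate)
open import Data.List.Membership.Propositional using (_∈_; find; lose)
open import Data.List.Membership.Propositional.Properties using (∈-insert)
import Data.List.Properties as List
open import Data.List.Relation.Unary.All as All using (All; []; _∷_)
import Data.List.Relation.Unary.All.Properties as All
open import Data.List.Relation.Unary.Any as Any using (Any; here; there)
open import Data.Maybe.Base using (Maybe; just; nothing)
open import Data.Nat.Base as ℕ
  using (_*_; _+_; _<_; _^_; _∸_; _≤_; suc; s≤s; s≤s⁻¹; zero; z≤n; ℕ)
open import Data.Nat.ListAction using (sum)
import Data.Nat.Properties as ℕ
open import Data.Product.Base using (_,_; _×_; map₁; map₂; proj₁; proj₂; Σ; ∃; ∃₂)
open import Data.Product.Function.Dependent.Propositional using (Σ-↔)
open import Data.Sum.Base using ([_,_]′; _⊎_; inj₁; inj₂)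
open import Data.Sum.Function.Propositional using (_⊎-↔_)
open import Data.Unit.Base using (tt; ⊤)
open import Data.Vec.Base as Vec using (Vec; []; _∷_)
import Data.Vec.Properties as Vec
open import Function.Base using (_∘_; const; id)
open import Function.Bundles using (Inverse; _↔_; mk↔ₛ′)
open import Function.Properties.Inverse using (↔-refl; ↔-sym; ↔-trans)
open import Induction.WellFounded using (Acc; acc)
open import Level using (0ℓ)
open import Relation.Binary.Definitions using (DecidableEquality)
open import Relation.Binary.PropositionalEquality
  using (_≗_; _≡_; _≢_; cong; cong₂; module ≡-Reasoning; refl; subst; subst₂; sym; trans)
open import Relation.Nullary using (Dec; contradiction; does; no; yes; ¬_)
open import Relation.Nullary.Decidable using (_→-dec_; dec-false; dec-true; from-yes)
open import Relation.Unary using (Pred)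

open Tape using (scanned; right)
open Vocabulary using (Symbol; arity)

-- Two obstacles shape the proof. First, the machine raises entries in the middle of a sweep, so its
-- trace is not a refinement sequence. The limit is therefore characterised without a process, by
-- `Reaches` and `Closed`; the stabilizing sequence that `IsLim` asks for is built separately, as a
-- finite chain of whole propagator applications, and uniqueness is proved for every ordinal length.
-- Both terminations rest on one measure, `totalDeficit`: a longest chain of truth values is `𝐮`,
-- `𝐭`, `𝐢`, hence the 2 per entry. A late change may enable a rule that was checked earlier, so
-- closedness is read off only from a sweep without changes. Second, running times are claimed for a
-- concrete transition function. Machines are assembled from a few combinators that return a result
-- in the finite control, and each restores its work tapes exactly; runs then compose by equality of
-- tapes, and time bounds follow the structure of the machine. Tapes are lists of cells, so a
-- visited blank differs from one beyond the end; the standard tapes contain their boundary blanks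
-- explicitly.

-- The precision order on truth values

-- Makes statements about all truth values decidable, so that the monotonicity laws of the
-- connectives are proved by evaluating a decision procedure on at most 256 cases.
all? : {P : Four → Set} → (∀ x → Dec (P x)) → Dec (∀ x → P x)
all? {P} P? with P? 𝐭 | P? 𝐟 | P? 𝐮 | P? 𝐢
... | yes t | yes f | yes u | yes i = yes λ { 𝐭 → t ; 𝐟 → f ; 𝐮 → u ; 𝐢 → i }
... | no ¬t | _     | _     | _     = no λ all → ¬t (all 𝐭)
... | yes _ | no ¬f | _     | _     = no λ all → ¬f (all 𝐟)
... | yes _ | yes _ | no ¬u | _     = no λ all → ¬u (all 𝐮)
... | yes _ | yes _ | yes _ | no ¬i = no λ all → ¬i (all 𝐢)

-- The number of steps by which a value can still grow in the precision order.
deficit : Four → ℕ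
deficit 𝐭 = 1
deficit 𝐟 = 1
deficit 𝐮 = 2
deficit 𝐢 = 0

≤p-trans : ∀ {x y z} → x ≤p y → y ≤p z → x ≤p z
≤p-trans 𝐮≤    _     = 𝐮≤
≤p-trans reflₚ q     = q
≤p-trans ≤𝐢    ≤𝐢    = ≤𝐢
≤p-trans ≤𝐢    reflₚ = ≤𝐢

≤p-antisym : ∀ {x y} → x ≤p y → y ≤p x → x ≡ y
≤p-antisym reflₚ _     = refl
≤p-antisym 𝐮≤    𝐮≤    = refl
≤p-antisym 𝐮≤    reflₚ = refl
≤p-antisym ≤𝐢    ≤𝐢    = refl
≤p-antisym ≤𝐢    reflₚ = refl

≤p-reflexive : ∀ {x y} → x ≡ y → x ≤p y
≤p-reflexive refl = reflₚ

_≟⁴_ : DecidableEquality Four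
x ≟⁴ y with x ≤p? y | y ≤p? x
... | yes p | yes q = yes (≤p-antisym p q)
... | no ¬p | _     = no λ x≡y → ¬p (≤p-reflexive x≡y)
... | yes _ | no ¬q = no λ x≡y → ¬q (≤p-reflexive (sym x≡y))

inverse-mono : ∀ x y → x ≤p y → inverse x ≤p inverse y
inverse-mono = from-yes (all? λ x → all? λ y → (x ≤p? y) →-dec (inverse x ≤p? inverse y))

∧t-mono : ∀ x x′ y y′ → x ≤p x′ → y ≤p y′ → (x ∧t y) ≤p (x′ ∧t y′)
∧t-mono = from-yes (all? λ x → all? λ x′ → all? λ y → all? λ y′ →
  (x ≤p? x′) →-dec ((y ≤p? y′) →-dec ((x ∧t y) ≤p? (x′ ∧t y′))))

∨t-mono : ∀ x x′ y y′ → x ≤p x′ → y ≤p y′ → (x ∨t y) ≤p (x′ ∨t y′)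
∨t-mono = from-yes (all? λ x → all? λ x′ → all? λ y → all? λ y′ →
  (x ≤p? x′) →-dec ((y ≤p? y′) →-dec ((x ∨t y) ≤p? (x′ ∨t y′))))

x≤x⊔y : ∀ x y → x ≤p (x ⊔p y)
x≤x⊔y x y = proj₁ (⊔p-supremum x y)

y≤x⊔y : ∀ x y → y ≤p (x ⊔p y)
y≤x⊔y x y = proj₁ (proj₂ (⊔p-supremum x y))

⊔p-monoʳ : ∀ x {y z} → y ≤p z → (x ⊔p y) ≤p (x ⊔p z)
⊔p-monoʳ x {y} {z} y≤z =
  proj₂ (proj₂ (⊔p-supremum x y)) _ (x≤x⊔y x z) (≤p-trans y≤z (y≤x⊔y x z))

deficit-anti : ∀ {x y} → x ≤p y → deficit y ≤ deficit x
deficit-anti {y = 𝐭} 𝐮≤ = s≤s z≤n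
deficit-anti {y = 𝐟} 𝐮≤ = s≤s z≤n
deficit-anti {y = 𝐮} 𝐮≤ = ℕ.≤-refl
deficit-anti {y = 𝐢} 𝐮≤ = z≤n
deficit-anti ≤𝐢         = z≤n
deficit-anti reflₚ      = ℕ.≤-refl

deficit-strict : ∀ {x y} → x ≤p y → ¬ x ≡ y → deficit y < deficit x
deficit-strict {y = 𝐭} 𝐮≤ _   = ℕ.≤-refl
deficit-strict {y = 𝐟} 𝐮≤ _   = ℕ.≤-refl
deficit-strict {y = 𝐮} 𝐮≤ x≢y = contradiction refl x≢y
deficit-strict {y = 𝐢} 𝐮≤ _   = s≤s z≤n
deficit-strict {x = 𝐭} ≤𝐢 _   = ℕ.≤-refl
deficit-strict {x = 𝐟} ≤𝐢 _   = ℕ.≤-refl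
deficit-strict {x = 𝐮} ≤𝐢 _   = s≤s z≤n
deficit-strict {x = 𝐢} ≤𝐢 x≢y = contradiction refl x≢y
deficit-strict reflₚ      x≢y = contradiction refl x≢y

-- Monotonicity of evaluation and of propagators

module _ {σ : Vocabulary} {n : ℕ} where

  ≤ˢ-trans : {I J K : Structure σ n} → I ≤ˢ J → J ≤ˢ K → I ≤ˢ K
  ≤ˢ-trans I≤J J≤K P ds = ≤p-trans (I≤J P ds) (J≤K P ds)

  ≤ˢ-reflexive : {I J : Structure σ n} → I ≈ˢ J → I ≤ˢ J
  ≤ˢ-reflexive I≈J P ds = ≤p-reflexive (I≈J P ds)

  ≤ˢ-antisym : {I J : Structure σ n} → I ≤ˢ J → J ≤ˢ I → I ≈ˢ J
  ≤ˢ-antisym I≤J J≤I P ds = ≤p-antisym (I≤J P ds) (J≤I P ds)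

  foldr-mono : ∀ {A : Set} {_∙_ : Four → Four → Four} →
    (∀ x x′ y y′ → x ≤p x′ → y ≤p y′ → (x ∙ y) ≤p (x′ ∙ y′)) →
    ∀ e {f g : A → Four} → (∀ a → f a ≤p g a) →
    ∀ as → foldr _∙_ e (List.map f as) ≤p foldr _∙_ e (List.map g as)
  foldr-mono mono e f≤g []       = reflₚ
  foldr-mono mono e f≤g (a ∷ as) = mono _ _ _ _ (f≤g a) (foldr-mono mono e f≤g as)

  -- Negation reverses the truth order but preserves the precision order, so the induction makes no
  -- distinction between positive and negative occurrences.
  eval-mono : ∀ {m} {I K : Structure σ n} → I ≤ˢ K →
    ∀ (φ : Formula σ m) θ → eval I θ φ ≤p eval K θ φ
  eval-mono I≤K (atom P xs) θ = I≤K P _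
  eval-mono I≤K (x ≐ y) θ with Vec.lookup θ x Fin.≟ Vec.lookup θ y
  ... | yes _ = reflₚ
  ... | no  _ = reflₚ
  eval-mono I≤K (not φ) θ = inverse-mono _ _ (eval-mono I≤K φ θ)
  eval-mono I≤K (φ and ψ) θ = ∧t-mono _ _ _ _ (eval-mono I≤K φ θ) (eval-mono I≤K ψ θ)
  eval-mono I≤K (φ or ψ) θ = ∨t-mono _ _ _ _ (eval-mono I≤K φ θ) (eval-mono I≤K ψ θ)
  eval-mono I≤K (all′ φ) θ = foldr-mono ∧t-mono _ (λ d → eval-mono I≤K φ (d ∷ θ)) (allFin n)
  eval-mono I≤K (ex′ φ) θ = foldr-mono ∨t-mono _ (λ d → eval-mono I≤K φ (d ∷ θ)) (allFin n)

  propagator-mono : ∀ φ {I K : Structure σ n} → I ≤ˢ K → propagator φ I ≤ˢ propagator φ K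
  propagator-mono (inf P s ψ) {I} {K} I≤K Q ds with P Fin.≟ Q
  ... | no _ = I≤K Q ds
  ... | yes refl with 𝐭 ≤p? eval I ds ψ | 𝐭 ≤p? eval K ds ψ
  ...   | yes _ | yes _ = ⊔p-monoʳ (literalValue s) (I≤K P ds)
  ...   | no _  | yes _ = ≤p-trans (I≤K P ds) (y≤x⊔y _ _)
  ...   | no _  | no _  = I≤K P ds
  ...   | yes p | no ¬p = contradiction (≤p-trans p (eval-mono I≤K ψ ds)) ¬p

  propagator-inflationary : ∀ φ (I : Structure σ n) → I ≤ˢ propagator φ I
  propagator-inflationary (inf P s ψ) I Q ds with P Fin.≟ Q
  ... | no _ = reflₚ
  ... | yes refl with 𝐭 ≤p? eval I ds ψ
  ...   | yes _ = y≤x⊔y _ _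
  ...   | no _  = reflₚ

-- Least fixpoints

module _ {σ : Vocabulary} (V : List (INF σ)) {n : ℕ} where

  -- Prefixpoints of all propagators; as propagators are inflationary, these are the common
  -- fixpoints.
  Closed : Structure σ n → Set
  Closed K = ∀ {φ} → φ ∈ V → propagator φ K ≤ˢ K

  propagator∈ : ∀ {φ} → φ ∈ V → propagators V (propagator {n = n} φ)
  propagator∈ = Any.map λ { refl → refl }

  -- No process is mentioned, so refinement sequences of any length and single-entry updates satisfy
  -- the same relation, and it composes. If `J` is also closed, it is the least closed structure
  -- above `I`.
  record Reaches (I J : Structure σ n) : Set where
    field
      above : I ≤ˢ J
      below : ∀ {K} → Closed K → I ≤ˢ K → J ≤ˢ K

  open Reaches public

  reaches-refl : ∀ {I} → Reaches I I
  reaches-refl = record { above = λ _ _ → reflₚ ; below = λ _ I≤K → I≤K }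

  reaches-trans : ∀ {I J K} → Reaches I J → Reaches J K → Reaches I K
  reaches-trans r s = record
    { above = ≤ˢ-trans (above r) (above s)
    ; below = λ closed → below s closed ∘ below r closed
    }

  -- For closed `K` above `I`: `J` is below `O I`, which is below `O K`, which is below `K`. Thus
  -- `J` may be any partial application of `O`.
  reaches-step : ∀ {O I J} → propagators V O → I ≤ˢ J → J ≤ˢ O I → Reaches I J
  reaches-step O∈W I≤J J≤O with find O∈W
  ... | φ , φ∈V , refl = record
    { above = I≤J
    ; below = λ closed I≤K →
        ≤ˢ-trans J≤O (≤ˢ-trans (propagator-mono φ I≤K) (closed φ∈V))
    }

  reaches-unique : ∀ {I J K} → Reaches I J → Closed J → Reaches I K → Closed K → J ≈ˢ K
  reaches-unique r J-closed s K-closed =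
    ≤ˢ-antisym (below r K-closed (above s)) (below s J-closed (above r))

  module _ {I : Structure σ n} (S : RefinementSequence (propagators V) I) where
    open RefinementSequence S hiding (_<_)

    reaches-index : ∀ ξ → Acc (RefinementSequence._<_ S) ξ → Reaches I (J ξ)
    reaches-index ξ (acc rec) with classify ξ
    ... | inj₁ zero-ξ = record
      { above = ≤ˢ-reflexive λ P ds → sym (initial ξ zero-ξ P ds)
      ; below = λ _ I≤K → ≤ˢ-trans (≤ˢ-reflexive (initial ξ zero-ξ)) I≤K
      }
    ... | inj₂ (inj₁ (η , succ)) with step ξ η succ
    ...   | O , O∈W , Jξ≈ = reaches-trans (reaches-index η (rec (proj₁ succ)))
      (reaches-step O∈W (proj₁ (increase ξ η succ)) (≤ˢ-reflexive Jξ≈))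
    -- A limit has some predecessor `η`, and `J ξ` lies above `I` through it; closed structures
    -- bound all earlier members and hence their least upper bound.
    reaches-index ξ (acc rec) | inj₂ (inj₂ lim@((η , η<ξ) , _)) = record
      { above = ≤ˢ-trans (above (reaches-index η (rec η<ξ))) (lub-upper ξ lim η η<ξ)
      ; below = λ {K} closed I≤K → lub-least ξ lim K λ ζ ζ<ξ →
          below (reaches-index ζ (rec ζ<ξ)) closed I≤K
      }

    reaches-last : Reaches I last
    reaches-last = reaches-index top (wellFounded top)

    stabilizing⇒closed : Stabilizing → Closed last
    stabilizing⇒closed stable φ∈V =
      ≤ˢ-reflexive (stable _ (propagator∈ φ∈V))

-- Finite refinement sequences

finiteOrdinal : ℕ → SuccessorOrdinal
finiteOrdinal k = record
  { Index              = Fin (suc k)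
  ; _<_                = Fin._<_
  ; isStrictTotalOrder = Fin.<-isStrictTotalOrder
  ; wellFounded        = Fin.<-wellFounded
  ; classify           = classify
  ; top                = Fin.fromℕ k
  ; top-max            = λ ξ k<ξ →
      ℕ.<⇒≱ (subst (_< toℕ ξ) (Fin.toℕ-fromℕ k) k<ξ) (Fin.toℕ≤pred[n] ξ)
  }
  where
  classify : ∀ (ξ : Fin (suc k)) → (∀ η → ¬ (η Fin.< ξ)) ⊎ _ ⊎ _
  classify Fin.zero    = inj₁ λ η ()
  classify (Fin.suc i) = inj₂ (inj₁ (inject₁ i , Fin.≤̄⇒inject₁< Fin.≤-refl ,
    λ ζ i<ζ ζ<1+i → ℕ.<⇒≱ (subst (_< toℕ ζ) (Fin.toℕ-inject₁ i) i<ζ) (s≤s⁻¹ ζ<1+i)))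

module _ (k : ℕ) where
  open SuccessorOrdinal (finiteOrdinal k)

  -- If `ξ` were larger than `suc η`, the element with number `suc η` would lie strictly between the
  -- two.
  toℕ-successor : ∀ {ξ η} → IsSuccessorOf ξ η → toℕ ξ ≡ suc (toℕ η)
  toℕ-successor {ξ} {η} (η<ξ , gap) with ℕ.m≤n⇒m<n∨m≡n η<ξ
  ... | inj₂ eq = sym eq
  ... | inj₁ 1+η<ξ = contradiction ζ<ξ (gap ζ η<ζ)
    where
    ζ = Fin.fromℕ< (ℕ.<-trans 1+η<ξ (Fin.toℕ<n ξ))
    ζ≡ = Fin.toℕ-fromℕ< (ℕ.<-trans 1+η<ξ (Fin.toℕ<n ξ))
    η<ζ = subst (toℕ η ℕ.<_) (sym ζ≡) ℕ.≤-refl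
    ζ<ξ = subst (ℕ._< toℕ ξ) (sym ζ≡) 1+η<ξ

  no-limit : ∀ {ξ} → ¬ IsLimit ξ
  no-limit {Fin.zero}  ((_ , ()) , _)
  no-limit {Fin.suc i} (_ , dense) with dense (inject₁ i) (Fin.≤̄⇒inject₁< Fin.≤-refl)
  ... | ζ , i<ζ , ζ<1+i = ℕ.<⇒≱ (subst (ℕ._< toℕ ζ) (Fin.toℕ-inject₁ i) i<ζ) (s≤s⁻¹ ζ<1+i)

module _ {σ : Vocabulary} {n : ℕ} (W : Pred (Operator σ n) 0ℓ) where

  -- Members are indexed by all numbers, with arbitrary values past `len`, so that extension at the
  -- front is a mere shift of the index.
  record Chain (I : Structure σ n) : Set where
    field
      len  : ℕ
      at   : ℕ → Structure σ n
      base : at 0 ≡ I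
      link : ∀ {i} → i < len → ∃ λ O → W O × at (suc i) ≡ O (at i) × at i <ˢ at (suc i)

  open Chain

  chain-sequence : ∀ {I} → Chain I → RefinementSequence W I
  chain-sequence c = record
    { ordinal   = finiteOrdinal (len c)
    ; J         = at c ∘ toℕ
    ; initial   = λ { Fin.zero _ P ds → cong (λ I → I P ds) (base c)
                    ; (Fin.suc i) min → contradiction (s≤s z≤n) (min Fin.zero) }
    ; step      = λ ξ η succ → let O , O∈W , eq , _ = link′ ξ η succ in
        O , O∈W , λ P ds → cong (λ I → I P ds) eq
    ; increase  = λ ξ η succ → let _ , _ , _ , lt = link′ ξ η succ in lt
    ; lub-upper = λ ξ lim → ⊥-elim (no-limit _ lim)
    ; lub-least = λ ξ lim → ⊥-elim (no-limit _ lim)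
    }
    where
    link′ : ∀ ξ η → SuccessorOrdinal.IsSuccessorOf (finiteOrdinal (len c)) ξ η →
      ∃ λ O → W O × at c (toℕ ξ) ≡ O (at c (toℕ η)) × at c (toℕ η) <ˢ at c (toℕ ξ)
    link′ ξ η succ rewrite toℕ-successor (len c) {ξ} {η} succ =
      link c (subst (_≤ len c) (toℕ-successor (len c) {ξ} {η} succ) (Fin.toℕ≤pred[n] ξ))

  chain-last : ∀ {I} (c : Chain I) →
    RefinementSequence.last (chain-sequence c) ≡ at c (len c)
  chain-last c = cong (at c) (Fin.toℕ-fromℕ (len c))

  chain-stop : ∀ {I} → Chain I
  chain-stop {I} = record { len = 0 ; at = λ _ → I ; base = refl ; link = λ () }

  chain-cons : ∀ {I O} → W O → I <ˢ O I → Chain (O I) → Chain I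
  chain-cons {I} {O} O∈W lt c = record
    { len  = suc (len c)
    ; at   = λ { zero → I ; (suc i) → at c i }
    ; base = refl
    ; link = λ { {zero} _ → O , O∈W , base c , subst (I <ˢ_) (sym (base c)) lt
               ; {suc i} (s≤s i<len) → link c i<len }
    }

-- Encodings

-- What the cells of an encoding stand for; their list depends only on n.
data Slot (σ : Vocabulary) (n : ℕ) : Set where
  unit  : Slot σ n
  sep   : Symbol σ → Slot σ n
  entry : (P : Symbol σ) → Vec (Fin n) (arity σ P) → Slot σ n

letter : ∀ {σ n} → Structure σ n → Slot σ n → Letter
letter I unit         = stroke
letter I (sep P)      = separator
letter I (entry P ds) = value (I P ds)

tableSlots : ∀ σ n → Symbol σ → List (Slot σ n)
tableSlots σ n P = sep P ∷ List.map (entry P) (tuples n (arity σ P))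

slots : ∀ σ n → List (Slot σ n)
slots σ n = List.replicate n unit List.++ List.concatMap (tableSlots σ n) (allFin _)

-- Polynomial bounds

-- Expressions instead of coefficient lists: their values unfold to sums and products of the same
-- form as the bounds of composed runs. Coefficients are computed once, at the end.
data Bound : Set where
  const′   : ℕ → Bound
  size     : Bound
  _⊕_ _⊛_  : Bound → Bound → Bound

infixl 6 _⊕_
infixl 7 _⊛_

⟦_⟧ᵇ : Bound → ℕ → ℕ
⟦ const′ c ⟧ᵇ n = c
⟦ size ⟧ᵇ n     = n
⟦ b ⊕ c ⟧ᵇ n    = ⟦ b ⟧ᵇ n + ⟦ c ⟧ᵇ n
⟦ b ⊛ c ⟧ᵇ n    = ⟦ b ⟧ᵇ n * ⟦ c ⟧ᵇ n

power : ℕ → Bound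
power zero    = const′ 1
power (suc k) = size ⊛ power k

⟦power⟧ : ∀ k n → ⟦ power k ⟧ᵇ n ≡ n ^ k
⟦power⟧ zero    n = refl
⟦power⟧ (suc k) n = cong (n *_) (⟦power⟧ k n)

_+ᵖ_ : Polynomial → Polynomial → Polynomial
[]      +ᵖ q       = q
(a ∷ p) +ᵖ []      = a ∷ p
(a ∷ p) +ᵖ (b ∷ q) = a + b ∷ (p +ᵖ q)

_*ᵖ_ : Polynomial → Polynomial → Polynomial
[]      *ᵖ q = []
(a ∷ p) *ᵖ q = map (a *_) q +ᵖ (0 ∷ (p *ᵖ q))

module _ (x : ℕ) where
  open import Data.Nat.Solver
  open +-*-Solver

  evalPoly-+ : ∀ p q → evalPoly (p +ᵖ q) x ≡ evalPoly p x + evalPoly q x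
  evalPoly-+ []      q       = refl
  evalPoly-+ (a ∷ p) []      = sym (ℕ.+-identityʳ _)
  evalPoly-+ (a ∷ p) (b ∷ q) = trans (cong (λ r → a + b + x * r) (evalPoly-+ p q))
    (solve 5 (λ a b x p q → a :+ b :+ x :* (p :+ q) := a :+ x :* p :+ (b :+ x :* q)) refl
      a b x (evalPoly p x) (evalPoly q x))

  evalPoly-scale : ∀ a q → evalPoly (map (a *_) q) x ≡ a * evalPoly q x
  evalPoly-scale a []      = sym (ℕ.*-zeroʳ a)
  evalPoly-scale a (b ∷ q) = trans (cong (λ r → a * b + x * r) (evalPoly-scale a q))
    (solve 4 (λ a b x q → a :* b :+ x :* (a :* q) := a :* (b :+ x :* q)) refl
      a b x (evalPoly q x))

  evalPoly-* : ∀ p q → evalPoly (p *ᵖ q) x ≡ evalPoly p x * evalPoly q x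
  evalPoly-* []      q = refl
  evalPoly-* (a ∷ p) q = begin
    evalPoly (map (a *_) q +ᵖ (0 ∷ (p *ᵖ q))) x
      ≡⟨ evalPoly-+ (map (a *_) q) _ ⟩
    evalPoly (map (a *_) q) x + x * evalPoly (p *ᵖ q) x
      ≡⟨ cong₂ (λ r s → r + x * s) (evalPoly-scale a q) (evalPoly-* p q) ⟩
    a * evalPoly q x + x * (evalPoly p x * evalPoly q x)
      ≡⟨ solve 4 (λ a x p q → a :* q :+ x :* (p :* q) := (a :+ x :* p) :* q) refl
           a x (evalPoly p x) (evalPoly q x) ⟩
    (a + x * evalPoly p x) * evalPoly q x ∎
    where open ≡-Reasoning

toPolynomial : Bound → Polynomial
toPolynomial (const′ c) = c ∷ []
toPolynomial size       = 0 ∷ 1 ∷ []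
toPolynomial (b ⊕ c)    = toPolynomial b +ᵖ toPolynomial c
toPolynomial (b ⊛ c)    = toPolynomial b *ᵖ toPolynomial c

evalPoly-toPolynomial : ∀ b n → evalPoly (toPolynomial b) n ≡ ⟦ b ⟧ᵇ n
evalPoly-toPolynomial (const′ c) n = trans (cong (c +_) (ℕ.*-zeroʳ n)) (ℕ.+-identityʳ c)
evalPoly-toPolynomial size       n =
  trans (cong (λ z → n * (1 + z)) (ℕ.*-zeroʳ n)) (ℕ.*-identityʳ n)
evalPoly-toPolynomial (b ⊕ c) n = trans (evalPoly-+ n (toPolynomial b) _)
  (cong₂ _+_ (evalPoly-toPolynomial b n) (evalPoly-toPolynomial c n))
evalPoly-toPolynomial (b ⊛ c) n = trans (evalPoly-* n (toPolynomial b) _)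
  (cong₂ _*_ (evalPoly-toPolynomial b n) (evalPoly-toPolynomial c n))

-- Positions of entries in the encoding

module _ {A : Set} where

  -- With `_≢ x` for `Other` this says that `x` occurs exactly once, at position `offset`, so
  -- overwriting that cell changes the label of `x` alone. A general `Other` lets the statement pass
  -- through `map` and `concatMap`.
  record Split (xs : List A) (x : A) (offset : ℕ) (Other : A → Set) : Set where
    field
      before after  : List A
      split         : xs ≡ before ++ x ∷ after
      length-before : length before ≡ offset
      before-other  : All Other before
      after-other   : All Other after

  open Split public

  split-cast : ∀ {xs ys x i j Other} → xs ≡ ys → i ≡ j →
    Split xs x i Other → Split ys x j Other
  split-cast refl refl s = s

  tabulate-split : ∀ {n} (f : Fin n → A) (i : Fin n) {Other : A → Set} →
    (∀ j → j ≢ i → Other (f j)) → Split (tabulate f) (f i) (toℕ i) Other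
  tabulate-split f Fin.zero other = record
    { before = [] ; after = _ ; split = refl ; length-before = refl ; before-other = []
    ; after-other = All.tabulate⁺ λ j → other (Fin.suc j) λ () }
  tabulate-split f (Fin.suc i) other =
    let s = tabulate-split (f ∘ Fin.suc) i λ j j≢i → other (Fin.suc j) (j≢i ∘ Fin.suc-injective)
    in record
    { before        = f Fin.zero ∷ before s
    ; after         = after s
    ; split         = cong (f Fin.zero ∷_) (split s)
    ; length-before = cong suc (length-before s)
    ; before-other  = other Fin.zero (λ ()) ∷ before-other s
    ; after-other   = after-other s
    }

  split-prepend : ∀ {xs x offset Other} ys → All Other ys →
    Split xs x offset Other → Split (ys ++ xs) x (length ys + offset) Other
  split-prepend ys ys-other s = record
    { before        = ys ++ before s
    ; after         = after s
    ; split         = trans (cong (ys ++_) (split s)) (sym (List.++-assoc ys _ _))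
    ; length-before = trans (List.length-++ ys) (cong (length ys +_) (length-before s))
    ; before-other  = All.++⁺ ys-other (before-other s)
    ; after-other   = after-other s
    }

  split-append : ∀ {xs x offset Other} ys → All Other ys →
    Split xs x offset Other → Split (xs ++ ys) x offset Other
  split-append ys ys-other s = record
    { before        = before s
    ; after         = after s ++ ys
    ; split         = trans (cong (_++ ys) (split s)) (List.++-assoc (before s) _ _)
    ; length-before = length-before s
    ; before-other  = before-other s
    ; after-other   = All.++⁺ (after-other s) ys-other
    }

sumBefore : ∀ {N} → (Fin N → ℕ) → Fin N → ℕ
sumBefore f Fin.zero    = 0
sumBefore f (Fin.suc i) = f Fin.zero + sumBefore (f ∘ Fin.suc) i

sumBefore-cong : ∀ {N} {f g : Fin N → ℕ} → f ≗ g → sumBefore f ≗ sumBefore g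
sumBefore-cong f≗g Fin.zero    = refl
sumBefore-cong f≗g (Fin.suc i) = cong₂ _+_ (f≗g Fin.zero) (sumBefore-cong (f≗g ∘ Fin.suc) i)

concatMap-split : ∀ {A B : Set} {N} (f : A → List B) (g : Fin N → A) (i : Fin N)
  {x offset Other} → (∀ j → j ≢ i → All Other (f (g j))) → Split (f (g i)) x offset Other →
  Split (concatMap f (tabulate g)) x (sumBefore (length ∘ f ∘ g) i + offset) Other
concatMap-split f g Fin.zero other s = split-append _
  (All.concat⁺ (All.map⁺ (All.tabulate⁺ λ j → other (Fin.suc j) λ ()))) s
concatMap-split f g (Fin.suc i) other s =
  split-cast refl (sym (ℕ.+-assoc (length (f (g Fin.zero))) _ _))
    (split-prepend _ (other Fin.zero λ ())
      (concatMap-split f (g ∘ Fin.suc) i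
        (λ j j≢i → other (Fin.suc j) (j≢i ∘ Fin.suc-injective)) s))

length-cartesianProductWith : ∀ {A B C : Set} (f : A → B → C) xs ys →
  length (cartesianProductWith f xs ys) ≡ length xs * length ys
length-cartesianProductWith f []       ys = refl
length-cartesianProductWith f (x ∷ xs) ys = begin
  length (map (f x) ys ++ cartesianProductWith f xs ys)
    ≡⟨ List.length-++ (map (f x) ys) ⟩
  length (map (f x) ys) + length (cartesianProductWith f xs ys)
    ≡⟨ cong₂ _+_ (List.length-map (f x) ys) (length-cartesianProductWith f xs ys) ⟩
  length ys + length xs * length ys ∎
  where open ≡-Reasoning

All-cartesianProductWith : ∀ {A B C : Set} {P : A → Set} {Q : C → Set} (f : A → B → C) →
  (∀ {a} → P a → ∀ b → Q (f a b)) → ∀ {xs} → All P xs → ∀ ys →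
  All Q (cartesianProductWith f xs ys)
All-cartesianProductWith f imp []         ys = []
All-cartesianProductWith f imp (px ∷ pxs) ys =
  All.++⁺ (All.map⁺ (All.universal (imp px) ys)) (All-cartesianProductWith f imp pxs ys)

length-tuples : ∀ n k → length (tuples n k) ≡ n ^ k
length-tuples n zero    = refl
length-tuples n (suc k) = trans (length-cartesianProductWith _∷_ (allFin n) (tuples n k))
  (cong₂ _*_ (List.length-tabulate {n = n} id) (length-tuples n k))

-- The position of a tuple in lexicographic order.
index : ∀ {n k} → Vec (Fin n) k → ℕ
index []                         = 0
index {n} {suc k} (d ∷ ds) = toℕ d * n ^ k + index ds

split-map : ∀ {A B : Set} {P Q} (f : A → B) → (∀ {a} → P a → Q (f a)) →
  ∀ {xs x offset} → Split xs x offset P → Split (map f xs) (f x) offset Q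
split-map f imp s = record
  { before        = map f (before s)
  ; after         = map f (after s)
  ; split         = trans (cong (map f) (split s)) (List.map-++ f (before s) _)
  ; length-before = trans (List.length-map f (before s)) (length-before s)
  ; before-other  = All.map⁺ (All.map imp (before-other s))
  ; after-other   = All.map⁺ (All.map imp (after-other s))
  }

-- The tuples with first component `d` form one block, a copy of `tuples n k`, behind `toℕ d` blocks
-- of length `n ^ k`.
tuples-split : ∀ {n k} (ds : Vec (Fin n) k) → Split (tuples n k) ds (index ds) (_≢ ds)
tuples-split [] = record
  { before = [] ; after = [] ; split = refl ; length-before = refl
  ; before-other = [] ; after-other = [] }
tuples-split {n} {suc k} (d ∷ ds) = split-cast eq len
  (split-prepend (cartesianProductWith _∷_ (before sd) T)
    (All-cartesianProductWith _∷_ head≢ (before-other sd) T)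
    (split-append (cartesianProductWith _∷_ (after sd) T)
      (All-cartesianProductWith _∷_ head≢ (after-other sd) T)
      (split-map (d ∷_) (λ { t≢ds refl → t≢ds refl }) (tuples-split ds))))
  where
  T = tuples n k
  sd = tabulate-split id d {_≢ d} (λ _ j≢d → j≢d)
  head≢ : ∀ {a} → a ≢ d → ∀ (t : Vec (Fin n) k) → a ∷ t ≢ d ∷ ds
  head≢ a≢d t refl = a≢d refl
  eq : cartesianProductWith _∷_ (before sd) T ++
       (map (d ∷_) T ++ cartesianProductWith _∷_ (after sd) T)
     ≡ tuples n (suc k)
  eq = trans (sym (List.cartesianProductWith-distribʳ-++ _∷_ (before sd) (d ∷ after sd) T))
    (cong (λ xs → cartesianProductWith _∷_ xs T) (sym (split sd)))
  len : length (cartesianProductWith _∷_ (before sd) T) + index ds ≡ index (d ∷ ds)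
  len = cong (_+ index ds) (trans (length-cartesianProductWith _∷_ (before sd) T)
    (cong₂ _*_ (length-before sd) (length-tuples n k)))

tableLength : ∀ σ → ℕ → Symbol σ → ℕ
tableLength σ n P = suc (n ^ arity σ P)

module _ {σ : Vocabulary} {n : ℕ} where

  encode-slots : (I : Structure σ n) → encode I ≡ map (letter I) (slots σ n)
  encode-slots I = sym (begin
    map (letter I) (replicate n unit ++ concatMap (tableSlots σ n) (allFin _))
      ≡⟨ List.map-++ (letter I) (replicate n unit) _ ⟩
    map (letter I) (replicate n unit) ++ map (letter I) (concatMap (tableSlots σ n) (allFin _))
      ≡⟨ cong₂ _++_ (List.map-replicate (letter I) n unit)
           (List.map-concatMap (letter I) (tableSlots σ n) (allFin _)) ⟩
    replicate n stroke ++ concatMap (map (letter I) ∘ tableSlots σ n) (allFin _)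
      ≡⟨ cong (replicate n stroke ++_) (List.concatMap-cong
           (λ P → cong (separator ∷_) (sym (List.map-∘ (tuples n (arity σ P))))) (allFin _)) ⟩
    encode I ∎)
    where open ≡-Reasoning

  length-tableSlots : ∀ P → length (tableSlots σ n P) ≡ tableLength σ n P
  length-tableSlots P =
    cong suc (trans (List.length-map (entry {σ} P) (tuples n (arity σ P)))
      (length-tuples n (arity σ P)))

  -- The offset consists of the `n` strokes, the tables before `P`, the separator of `P` (the `suc`)
  -- and the lexicographic position; `access` travels these distances in this order.
  slots-split : ∀ P ds → Split (slots σ n) (entry P ds)
    (n + (sumBefore (tableLength σ n) P + suc (index ds))) (_≢ entry P ds)
  slots-split P ds = split-cast refl
    (cong₂ _+_ (List.length-replicate n)
      (cong (_+ suc (index ds)) (sumBefore-cong length-tableSlots P)))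
    (split-prepend _ (All.replicate⁺ n λ ())
      (concatMap-split (tableSlots σ n) id P
        (λ Q Q≢P → (λ ()) ∷ All.map⁺ (All.universal (λ es → λ { refl → Q≢P refl }) _))
        (split-prepend (sep P ∷ []) ((λ ()) ∷ [])
          (split-map (entry P) (λ { es≢ds refl → es≢ds refl }) (tuples-split ds)))))

  entry∈slots : ∀ P ds → entry P ds ∈ slots σ n
  entry∈slots P ds = let s = slots-split P ds in
    subst (entry P ds ∈_) (sym (split s)) (∈-insert (before s))

-- Number of slots and total deficit

sumBound : ∀ {N} → (Fin N → Bound) → Bound
sumBound {zero}  f = const′ 0
sumBound {suc N} f = f Fin.zero ⊕ sumBound (f ∘ Fin.suc)

length-concatMap-tabulate : ∀ {A B : Set} {N n} (f : A → List B) (g : Fin N → A)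
  (b : Fin N → Bound) →
  (∀ i → length (f (g i)) ≡ ⟦ b i ⟧ᵇ n) →
  length (concatMap f (tabulate g)) ≡ ⟦ sumBound b ⟧ᵇ n
length-concatMap-tabulate {N = zero}  f g b eq = refl
length-concatMap-tabulate {N = suc N} f g b eq = trans (List.length-++ (f (g Fin.zero)))
  (cong₂ _+_ (eq Fin.zero) (length-concatMap-tabulate f (g ∘ Fin.suc) (b ∘ Fin.suc) (eq ∘ Fin.suc)))

slotsBound : Vocabulary → Bound
slotsBound σ = size ⊕ sumBound (λ P → const′ 1 ⊕ power (arity σ P))

length-slots : ∀ σ n → length (slots σ n) ≡ ⟦ slotsBound σ ⟧ᵇ n
length-slots σ n = trans (List.length-++ (replicate n unit))
  (cong₂ _+_ (List.length-replicate n)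
    (length-concatMap-tabulate (tableSlots σ n) id (λ P → const′ 1 ⊕ power (arity σ P))
      λ P → trans (length-tableSlots {σ} {n} P) (cong suc (sym (⟦power⟧ (arity σ P) n)))))

slotDeficit : ∀ {σ n} → Structure σ n → Slot σ n → ℕ
slotDeficit I (entry P ds) = deficit (I P ds)
slotDeficit I _            = 0

-- The termination measure, both for the sweeps of the machine and for the chain of propagator
-- applications.
totalDeficit : ∀ {σ n} → Structure σ n → ℕ
totalDeficit {σ} {n} I = sum (map (slotDeficit I) (slots σ n))

module _ {A : Set} {f g : A → ℕ} where

  sum-mono : (∀ x → f x ≤ g x) → ∀ xs → sum (map f xs) ≤ sum (map g xs)
  sum-mono f≤g []       = z≤n
  sum-mono f≤g (x ∷ xs) = ℕ.+-mono-≤ (f≤g x) (sum-mono f≤g xs)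

  sum-strict : (∀ x → f x ≤ g x) → ∀ {x xs} → x ∈ xs → f x < g x →
    sum (map f xs) < sum (map g xs)
  sum-strict f≤g {xs = _ ∷ xs} (here refl) lt = ℕ.+-mono-<-≤ lt (sum-mono f≤g xs)
  sum-strict f≤g (there x∈xs)  lt = ℕ.+-mono-≤-< (f≤g _) (sum-strict f≤g x∈xs lt)

sum-≤-length : ∀ {A : Set} {f : A → ℕ} {c} → (∀ x → f x ≤ c) → ∀ xs → sum (map f xs) ≤ length xs * c
sum-≤-length f≤c []       = z≤n
sum-≤-length f≤c (x ∷ xs) = ℕ.+-mono-≤ (f≤c x) (sum-≤-length f≤c xs)

module _ {σ : Vocabulary} {n : ℕ} where

  slotDeficit-anti : {I J : Structure σ n} → I ≤ˢ J → ∀ x → slotDeficit J x ≤ slotDeficit I x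
  slotDeficit-anti I≤J unit         = z≤n
  slotDeficit-anti I≤J (sep P)      = z≤n
  slotDeficit-anti I≤J (entry P ds) = deficit-anti (I≤J P ds)

  totalDeficit-strict : {I J : Structure σ n} → I ≤ˢ J → ∀ P ds → I P ds ≢ J P ds →
    totalDeficit J < totalDeficit I
  totalDeficit-strict I≤J P ds I≢J =
    sum-strict (slotDeficit-anti I≤J) (entry∈slots P ds) (deficit-strict (I≤J P ds) I≢J)

  totalDeficit-bound : (I : Structure σ n) → totalDeficit I ≤ ⟦ slotsBound σ ⊛ const′ 2 ⟧ᵇ n
  totalDeficit-bound I = ℕ.≤-trans (sum-≤-length slot≤2 (slots σ n))
    (ℕ.≤-reflexive (cong (_* 2) (length-slots σ n)))
    where
    slot≤2 : ∀ x → slotDeficit I x ≤ 2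
    slot≤2 unit    = z≤n
    slot≤2 (sep P) = z≤n
    slot≤2 (entry P ds) = deficit-anti {𝐮} {I P ds} 𝐮≤

  totalDeficit-cong : {I J : Structure σ n} → I ≈ˢ J → totalDeficit I ≡ totalDeficit J
  totalDeficit-cong {I} {J} I≈J = cong sum (List.map-cong same (slots σ n))
    where
    same : slotDeficit I ≗ slotDeficit J
    same unit         = refl
    same (sep P)      = refl
    same (entry P ds) = cong deficit (I≈J P ds)

-- Finite types

abstract

  finite-⊥ : Finite ⊥
  finite-⊥ = 0 , ↔-sym Fin.0↔⊥

  finite-⊤ : Finite ⊤
  finite-⊤ = 1 , ↔-sym Fin.1↔⊤

  finite-Bool : Finite Bool
  finite-Bool = 2 , ↔-sym Fin.2↔Bool

  finite-⊎ : ∀ {A B} → Finite A → Finite B → Finite (A ⊎ B)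
  finite-⊎ (k , f) (l , g) = k + l , ↔-trans (f ⊎-↔ g) (↔-sym Fin.+↔⊎)

  finite-↔ : ∀ {A B} → A ↔ B → Finite B → Finite A
  finite-↔ f (k , g) = k , ↔-trans f g

  finite-Four : Finite Four
  finite-Four = finite-↔ (mk↔ₛ′ to from (λ { (inj₁ true) → refl ; (inj₁ false) → refl
                                             ; (inj₂ true) → refl ; (inj₂ false) → refl })
                                         (λ { 𝐭 → refl ; 𝐟 → refl ; 𝐮 → refl ; 𝐢 → refl }))
    (finite-⊎ finite-Bool finite-Bool)
    where
    to : Four → Bool ⊎ Bool
    to 𝐭 = inj₁ true
    to 𝐟 = inj₁ false
    to 𝐮 = inj₂ true
    to 𝐢 = inj₂ false
    from : Bool ⊎ Bool → Four
    from (inj₁ true)  = 𝐭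
    from (inj₁ false) = 𝐟
    from (inj₂ true)  = 𝐮
    from (inj₂ false) = 𝐢

  finite-ΣFin : ∀ k {B : Fin k → Set} → (∀ i → Finite (B i)) → Finite (Σ (Fin k) B)
  finite-ΣFin zero    fin = finite-↔ (mk↔ₛ′ (λ ()) (λ ()) (λ ()) λ ()) finite-⊥
  finite-ΣFin (suc k) fin = finite-↔
    (mk↔ₛ′ (λ { (Fin.zero , b) → inj₁ b ; (Fin.suc i , b) → inj₂ (i , b) })
           (λ { (inj₁ b) → Fin.zero , b ; (inj₂ (i , b)) → Fin.suc i , b })
           (λ { (inj₁ _) → refl ; (inj₂ _) → refl })
           (λ { (Fin.zero , _) → refl ; (Fin.suc _ , _) → refl }))
    (finite-⊎ (fin Fin.zero) (finite-ΣFin k (fin ∘ Fin.suc)))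

  finite-Σ : ∀ {A} {B : A → Set} → Finite A → (∀ a → Finite (B a)) → Finite (Σ A B)
  finite-Σ {A} {B} (k , f) fin = finite-↔
    (↔-sym (Σ-↔ {A = B ∘ Inverse.from f} {B = B} (↔-sym f) λ {i} → ↔-refl))
    (finite-ΣFin k (fin ∘ Inverse.from f))

-- Systems of tapes

-- A tree of tapes: a submachine owns subtrees, and pairing replaces arithmetic on tape numbers,
-- which is left to the final conversion.
data Shape : Set where
  ∅ •  : Shape
  _⊗_  : Shape → Shape → Shape

infixr 6 _⊗_

⟦_⟧ : Shape → Set → Set
⟦ ∅ ⟧ X     = ⊤
⟦ • ⟧ X     = X
⟦ F ⊗ G ⟧ X = ⟦ F ⟧ X × ⟦ G ⟧ X

vec : ℕ → Shape
vec zero    = ∅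
vec (suc k) = • ⊗ vec k

mapˢ : ∀ F {X Y} → (X → Y) → ⟦ F ⟧ X → ⟦ F ⟧ Y
mapˢ ∅       f x       = tt
mapˢ •       f x       = f x
mapˢ (F ⊗ G) f (x , y) = mapˢ F f x , mapˢ G f y

zipˢ : ∀ F {X Y Z} → (X → Y → Z) → ⟦ F ⟧ X → ⟦ F ⟧ Y → ⟦ F ⟧ Z
zipˢ ∅       f x       y         = tt
zipˢ •       f x       y         = f x y
zipˢ (F ⊗ G) f (x , y) (x′ , y′) = zipˢ F f x x′ , zipˢ G f y y′

fill : ∀ F {X} → X → ⟦ F ⟧ X
fill ∅       x = tt
fill •       x = x
fill (F ⊗ G) x = fill F x , fill G x

zipˢ-fill : ∀ F {X Y Z} (f : X → Y → Z) x y → zipˢ F f (fill F x) (fill F y) ≡ fill F (f x y)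
zipˢ-fill ∅       f x y = refl
zipˢ-fill •       f x y = refl
zipˢ-fill (F ⊗ G) f x y = cong₂ _,_ (zipˢ-fill F f x y) (zipˢ-fill G f x y)

-- There are no auxiliary symbols: `stroke` and `separator` also serve as plain and marked cells of
-- the work tapes.
Symb : Set
Symb = Letter ⊎ ⊥

Cell : Set
Cell = Maybe Symb

T : Set
T = Tape Symb

Action : Set
Action = Cell × Move

act : Action → T → T
act (a , m) t = move m (write a t)

hold : Cell → Action
hold c = c , stay

-- A transition acts on all tapes at once; a tape is left alone by rewriting the symbol that it
-- scans.
hold-all : ∀ F (ts : ⟦ F ⟧ T) → zipˢ F act (mapˢ F hold (mapˢ F scanned ts)) ts ≡ ts
hold-all ∅       ts        = refl
hold-all •       ts        = refl
hold-all (F ⊗ G) (ts , us) = cong₂ _,_ (hold-all F ts) (hold-all G us)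

-- Machines that return a result

-- The last transition both acts and delivers the result, so a composite enters the next machine in
-- the same step and the bounds of the parts simply add up.
record Machine (F : Shape) (A : Set) : Set₁ where
  no-eta-equality
  field
    State  : Set
    finite : Finite State
    start  : State
    δ      : State → ⟦ F ⟧ Cell → (State ⊎ A) × ⟦ F ⟧ Action

open Machine

-- The number bounds the length of the run.
data Runs {F A} (M : Machine F A) : State M → ⟦ F ⟧ T → ℕ → A → ⟦ F ⟧ T → Set where
  exit : ∀ {q ts ts′ as b a} → δ M q (mapˢ F scanned ts) ≡ (inj₂ a , as) →
         zipˢ F act as ts ≡ ts′ → Runs M q ts (suc b) a ts′
  step : ∀ {q q′ ts ts′ ts″ as b a} → δ M q (mapˢ F scanned ts) ≡ (inj₁ q′ , as) →
         zipˢ F act as ts ≡ ts′ → Runs M q′ ts′ b a ts″ → Runs M q ts (suc b) a ts″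

infix 4 _⊢_⟶[_]_,_

_⊢_⟶[_]_,_ : ∀ {F A} → Machine F A → ⟦ F ⟧ T → ℕ → A → ⟦ F ⟧ T → Set
M ⊢ ts ⟶[ b ] a , ts′ = Runs M (start M) ts b a ts′

weaken : ∀ {F A} {M : Machine F A} {q ts b c a ts′} → b ≤ c →
  Runs M q ts b a ts′ → Runs M q ts c a ts′
weaken (s≤s b≤c) (exit e z)   = exit e z
weaken (s≤s b≤c) (step e z r) = step e z (weaken b≤c r)

cast-end : ∀ {F A} {M : Machine F A} {q ts b a ts′ ts″} → ts′ ≡ ts″ →
  Runs M q ts b a ts′ → Runs M q ts b a ts″
cast-end refl r = r

cast-result : ∀ {F A} {M : Machine F A} {q ts b a a′ ts′} → a ≡ a′ →
  Runs M q ts b a ts′ → Runs M q ts b a′ ts′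
cast-result refl r = r

-- Sequencing and iteration of machines

module _ {F : Shape} where

  module _ {A B : Set} {X Y : Set} where

    after-first : (A → Y) → X ⊎ A → (X ⊎ Y) ⊎ B
    after-first next = inj₁ ∘ [ inj₁ , inj₂ ∘ next ]′

    after-second : (X → Y) → X ⊎ B → (A ⊎ Y) ⊎ B
    after-second tag = [ inj₁ ∘ inj₂ ∘ tag , inj₂ ]′

    after-iteration : (X → Y) → (A → Y) → X ⊎ (A ⊎ B) → Y ⊎ B
    after-iteration tag next = [ inj₁ ∘ tag , [ inj₁ ∘ next , inj₂ ]′ ]′

  module Bind {A B} (finA : Finite A) (M : Machine F A) (N : A → Machine F B) where

    machine : Machine F B
    machine = record
      -- The state of the second machine carries the result of the first, which is why results range
      -- over a finite type.
      { State  = State M ⊎ Σ _ (State ∘ N)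
      ; finite = finite-⊎ (finite M) (finite-Σ finA (finite ∘ N))
      ; start  = inj₁ (start M)
      ; δ      = λ
        { (inj₁ q) cs       → map₁ (after-first λ a → a , start (N a)) (δ M q cs)
        ; (inj₂ (a , q)) cs → map₁ (after-second (a ,_)) (δ (N a) q cs)
        }
      }

    second : ∀ {a q ts c x ts′} → Runs (N a) q ts c x ts′ → Runs machine (inj₂ (a , q)) ts c x ts′
    second (exit e z)   = exit (cong (map₁ (after-second _)) e) z
    second (step e z r) = step (cong (map₁ (after-second _)) e) z (second r)

    first : ∀ {q ts b a ts′ c x ts″} → Runs M q ts b a ts′ → N a ⊢ ts′ ⟶[ c ] x , ts″ →
      Runs machine (inj₁ q) ts (b + c) x ts″
    first (exit {b = b} e z) s =
      step (cong (map₁ (after-first _)) e) z (weaken (ℕ.m≤n+m _ b) (second s))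
    first (step e z r) s = step (cong (map₁ (after-first _)) e) z (first r s)

  module Iterate {A B} (finA : Finite A) (N : A → Machine F (A ⊎ B)) where

    machine : A → Machine F B
    machine a₀ = record
      { State  = Σ _ (State ∘ N)
      ; finite = finite-Σ finA (finite ∘ N)
      ; start  = a₀ , start (N a₀)
      ; δ      = λ (a , q) cs →
          map₁ (after-iteration (a ,_) λ a′ → a′ , start (N a′)) (δ (N a) q cs)
      }

    -- Loops with different initial values differ only in their start state; hence a run of the
    -- remaining rounds is also a run of the loop in progress.
    from-start : ∀ {a a′ q ts b x ts′} → Runs (machine a) q ts b x ts′ →
      Runs (machine a′) q ts b x ts′
    from-start {a} {a′} (exit e z)   = exit e z
    from-start {a} {a′} (step e z r) = step e z (from-start {a} {a′} r)

    module _ {a₀ : A} where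

      again : ∀ {a q ts b a′ ts′ c x ts″} → Runs (N a) q ts b (inj₁ a′) ts′ →
        Runs (machine a₀) (a′ , start (N a′)) ts′ c x ts″ →
        Runs (machine a₀) (a , q) ts (b + c) x ts″
      again (exit {b = b} e z) s =
        step (cong (map₁ (after-iteration _ _)) e) z (weaken (ℕ.m≤n+m _ b) s)
      again (step e z r) s = step (cong (map₁ (after-iteration _ _)) e) z (again r s)

      final : ∀ {a q ts b x ts′} → Runs (N a) q ts b (inj₂ x) ts′ →
        Runs (machine a₀) (a , q) ts b x ts′
      final (exit e z)   = exit (cong (map₁ (after-iteration _ _)) e) z
      final (step e z r) = step (cong (map₁ (after-iteration _ _)) e) z (final r)

  -- Abstract, so that unification can recover the machine from a run.
  abstract

    prim : ∀ {A} → (⟦ F ⟧ Cell → A × ⟦ F ⟧ Action) → Machine F A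
    prim f = record { State = ⊤ ; finite = finite-⊤ ; start = tt ; δ = λ _ → map₁ inj₂ ∘ f }

    bind : ∀ {A B} → Finite A → Machine F A → (A → Machine F B) → Machine F B
    bind = Bind.machine

    iterate : ∀ {A B} → Finite A → (A → Machine F (A ⊎ B)) → A → Machine F B
    iterate = Iterate.machine

    prim-run : ∀ {A} {f : ⟦ F ⟧ Cell → A × ⟦ F ⟧ Action} {ts ts′ a as} →
      f (mapˢ F scanned ts) ≡ (a , as) → zipˢ F act as ts ≡ ts′ → prim f ⊢ ts ⟶[ 1 ] a , ts′
    prim-run e z = exit (cong (map₁ inj₂) e) z

    bind-run : ∀ {A B} {finA : Finite A} {M : Machine F A} {N : A → Machine F B}
      {ts b a ts′ c x ts″} → M ⊢ ts ⟶[ b ] a , ts′ → N a ⊢ ts′ ⟶[ c ] x , ts″ →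
      bind finA M N ⊢ ts ⟶[ b + c ] x , ts″
    bind-run {finA = finA} {M} {N} = Bind.first finA M N

    iterate-more : ∀ {A B} {finA : Finite A} {N : A → Machine F (A ⊎ B)}
      {a ts b a′ ts′ c x ts″} → N a ⊢ ts ⟶[ b ] inj₁ a′ , ts′ →
      iterate finA N a′ ⊢ ts′ ⟶[ c ] x , ts″ → iterate finA N a ⊢ ts ⟶[ b + c ] x , ts″
    iterate-more {finA = finA} {N} {a} {a′ = a′} r s =
      Iterate.again finA N {a} r (Iterate.from-start finA N {a′} {a} s)

    iterate-done : ∀ {A B} {finA : Finite A} {N : A → Machine F (A ⊎ B)} {a ts b x ts′} →
      N a ⊢ ts ⟶[ b ] inj₂ x , ts′ → iterate finA N a ⊢ ts ⟶[ b ] x , ts′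
    iterate-done {finA = finA} {N} {a} = Iterate.final finA N {a}

  ret : ∀ {A} → A → Machine F A
  ret a = prim λ cs → a , mapˢ F hold cs

  ret-run : ∀ {A} {a : A} {ts} → ret a ⊢ ts ⟶[ 1 ] a , ts
  ret-run {ts = ts} = prim-run refl (hold-all F ts)

-- Running a machine on some of the tapes

-- A lens onto some of the tapes. Naturality of `from` for maps and zips makes scanning and acting
-- commute with the embedding, so each transition can be replayed inside the larger system.
record Focus (F G : Shape) : Set₁ where
  field
    Rest     : Shape
    to       : ∀ {X} → ⟦ F ⟧ X → ⟦ G ⟧ X × ⟦ Rest ⟧ X
    from     : ∀ {X} → ⟦ G ⟧ X × ⟦ Rest ⟧ X → ⟦ F ⟧ X
    to-from  : ∀ {X} (x : ⟦ G ⟧ X × ⟦ Rest ⟧ X) → to (from x) ≡ x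
    map-from : ∀ {X Y} (f : X → Y) (x : ⟦ G ⟧ X × ⟦ Rest ⟧ X) →
      mapˢ F f (from x) ≡ from (mapˢ G f (proj₁ x) , mapˢ Rest f (proj₂ x))
    zip-from : ∀ {X Y Z} (f : X → Y → Z) (x : ⟦ G ⟧ X × ⟦ Rest ⟧ X) (y : ⟦ G ⟧ Y × ⟦ Rest ⟧ Y) →
      zipˢ F f (from x) (from y)
        ≡ from (zipˢ G f (proj₁ x) (proj₁ y) , zipˢ Rest f (proj₂ x) (proj₂ y))

open Focus

module On {F G : Shape} (f : Focus F G) {A} (M : Machine G A) where

  machine : Machine F A
  machine = record
    { State  = State M
    ; finite = finite M
    ; start  = start M
    ; δ      = λ q cs → let gs , hs = to f cs in
        map₂ (λ as → from f (as , mapˢ (Rest f) hold hs)) (δ M q gs)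
    }

  module _ {gs : ⟦ G ⟧ T} {hs : ⟦ Rest f ⟧ T} where

    δ-machine : ∀ {q x as} → δ M q (mapˢ G scanned gs) ≡ (x , as) →
      δ machine q (mapˢ F scanned (from f (gs , hs)))
        ≡ (x , from f (as , mapˢ (Rest f) hold (mapˢ (Rest f) scanned hs)))
    δ-machine e rewrite map-from f scanned (gs , hs)
      | to-from f (mapˢ G scanned gs , mapˢ (Rest f) scanned hs) | e = refl

    act-machine : ∀ {as gs′} → zipˢ G act as gs ≡ gs′ →
      zipˢ F act (from f (as , mapˢ (Rest f) hold (mapˢ (Rest f) scanned hs))) (from f (gs , hs))
        ≡ from f (gs′ , hs)
    act-machine z =
      trans (zip-from f act _ _) (cong₂ (λ gs′ hs′ → from f (gs′ , hs′)) z (hold-all (Rest f) hs))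

  run : ∀ {q gs b a gs′ hs} → Runs M q gs b a gs′ →
    Runs machine q (from f (gs , hs)) b a (from f (gs′ , hs))
  run (exit e z)   = exit (δ-machine e) (act-machine z)
  run (step e z r) = step (δ-machine e) (act-machine z) (run r)

module _ {F G : Shape} (f : Focus F G) where

  abstract

    on : ∀ {A} → Machine G A → Machine F A
    on = On.machine f

    on-run : ∀ {A} {M : Machine G A} {gs b a gs′} (hs : ⟦ Rest f ⟧ T) → M ⊢ gs ⟶[ b ] a , gs′ →
      on M ⊢ from f (gs , hs) ⟶[ b ] a , from f (gs′ , hs)
    on-run {M = M} hs = On.run f M

fst′ : ∀ {F G} → Focus (F ⊗ G) F
fst′ {F} {G} = record
  { Rest = G ; to = id ; from = id ; to-from = λ _ → refl
  ; map-from = λ _ _ → refl ; zip-from = λ _ _ _ → refl }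

snd′ : ∀ {F G} → Focus (F ⊗ G) G
snd′ {F} {G} = record
  { Rest = F ; to = λ (x , y) → y , x ; from = λ (y , x) → x , y ; to-from = λ _ → refl
  ; map-from = λ _ _ → refl ; zip-from = λ _ _ _ → refl }

-- Head movements and rewinding

-- The head scans the first cell of the second list, or a blank if there is none.
at : List Cell → List Cell → T
at ls []       = tape ls nothing []
at ls (c ∷ rs) = tape ls c rs

goRight-at : ∀ ls c rs → move goRight (tape ls c rs) ≡ at (c ∷ ls) rs
goRight-at ls c []       = refl
goRight-at ls c (r ∷ rs) = refl

-- One explicit blank, the sentinel at which `rewind` and the loops stop. It has to be present in
-- the list from the start, or restored tapes would not be equal to the original ones.
blank : List Cell
blank = nothing ∷ []

tick mark : Symb
tick = inj₁ stroke
mark = inj₁ separator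

ticks : ℕ → List Cell
ticks k = List.replicate k (just tick)

ticks-ʳ++ : ∀ k rs → ticks k ʳ++ rs ≡ ticks k ++ rs
ticks-ʳ++ zero    rs = refl
ticks-ʳ++ (suc k) rs = trans (ticks-ʳ++ k (just tick ∷ rs)) (shift k)
  where
  shift : ∀ k → ticks k ++ just tick ∷ rs ≡ just tick ∷ ticks k ++ rs
  shift zero    = refl
  shift (suc k) = cong (just tick ∷_) (shift k)

rights : ℕ → T → T
rights zero    t = t
rights (suc k) t = move goRight (rights k t)

rights-+ : ∀ a b t → rights (a + b) t ≡ rights a (rights b t)
rights-+ zero    b t = refl
rights-+ (suc a) b t = cong (move goRight) (rights-+ a b t)

rights-at : ∀ ls xs ys → rights (length xs) (at ls (xs ++ ys)) ≡ at (xs ʳ++ ls) ys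
rights-at ls []       ys = refl
rights-at ls (x ∷ xs) ys = begin
  rights (1 + length xs) (tape ls x (xs ++ ys))
    ≡⟨ cong (λ k → rights k (tape ls x (xs ++ ys))) (ℕ.+-comm 1 (length xs)) ⟩
  rights (length xs + 1) (tape ls x (xs ++ ys))
    ≡⟨ rights-+ (length xs) 1 _ ⟩
  rights (length xs) (move goRight (tape ls x (xs ++ ys)))
    ≡⟨ cong (rights (length xs)) (goRight-at ls x (xs ++ ys)) ⟩
  rights (length xs) (at (x ∷ ls) (xs ++ ys))
    ≡⟨ rights-at (x ∷ ls) xs ys ⟩
  at (xs ʳ++ (x ∷ ls)) ys ∎
  where open ≡-Reasoning

moveRight : Machine • ⊤
moveRight = prim λ c → tt , c , goRight

moveRight-run : ∀ {t} → moveRight ⊢ t ⟶[ 1 ] tt , move goRight t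
moveRight-run = prim-run refl refl

rewind : Machine • ⊤
rewind = iterate finite-⊤ (λ _ → prim λ { nothing  → inj₂ tt , nothing , goRight
                                        ; (just x) → inj₁ tt , just x , goLeft }) tt

rewind-run : ∀ xs y ls rs →
  rewind ⊢ tape (map just xs ++ nothing ∷ ls) (just y) rs
    ⟶[ 2 + length xs ] tt , at (nothing ∷ ls) (map just xs ʳ++ just y ∷ rs)
rewind-run []       y ls rs = iterate-more (prim-run refl refl) (iterate-done (prim-run refl refl))
rewind-run (x ∷ xs) y ls rs = iterate-more (prim-run refl refl) (rewind-run xs x ls (just y ∷ rs))

-- The left part of a tape is stored nearest first, hence reversed; this is `rewind-run` for a word
-- given in reading order.
rewind-back : ∀ xs y ls rs →
  rewind ⊢ tape (map just xs ʳ++ nothing ∷ ls) (just y) rs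
    ⟶[ 2 + length xs ] tt , at (nothing ∷ ls) (map just xs ++ just y ∷ rs)
rewind-back xs y ls rs = subst
  (λ k → rewind ⊢ tape (map just xs ʳ++ nothing ∷ ls) (just y) rs
    ⟶[ 2 + k ] tt , at (nothing ∷ ls) (map just xs ++ just y ∷ rs))
  (List.length-reverse xs)
  (subst₂
    (λ l r → rewind ⊢ tape l (just y) rs ⟶[ 2 + length (reverse xs) ] tt , at (nothing ∷ ls) r)
    (trans (cong (_++ nothing ∷ ls) (List.reverse-map just xs)) (sym (List.ʳ++-defn (map just xs))))
    (trans (cong (_ʳ++ just y ∷ rs) (List.reverse-map just xs)) (List.ʳ++-ʳ++ (map just xs)))
    (rewind-run (reverse xs) y ls rs))

-- Loops controlled by a counter tape

idle : ℕ → T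
idle n = at blank (ticks n ++ blank)

markedAt : ℕ → ℕ → T
markedAt n i = tape (ticks i ++ blank) (just mark) (ticks (n ∸ suc i) ++ blank)

-- The value d of a variable: cell d of the n cells is marked and scanned.
counter : ∀ {n} → Fin n → T
counter {n} d = markedAt n (toℕ d)

-- The tape after a left move out of cell i, which may lead to the leading blank.
beforeCell : ℕ → List Cell → T
beforeCell zero    rs = tape [] nothing rs
beforeCell (suc i) rs = tape (ticks i ++ blank) (just tick) rs

goLeft-ticks : ∀ i c rs → move goLeft (tape (ticks i ++ blank) c rs) ≡ beforeCell i (c ∷ rs)
goLeft-ticks zero    c rs = refl
goLeft-ticks (suc i) c rs = refl

goRight-idle : ∀ n → move goRight (tape [] nothing (ticks n ++ blank)) ≡ idle n
goRight-idle zero    = refl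
goRight-idle (suc n) = refl

toEnd : Machine • ⊤
toEnd = iterate finite-⊤ (λ _ → prim λ { nothing  → inj₂ tt , nothing , goLeft
                                       ; (just x) → inj₁ tt , just x , goRight }) tt

toEnd-run : ∀ n ls → toEnd ⊢ at ls (ticks n ++ blank) ⟶[ suc n ] tt ,
  move goLeft (tape (ticks n ʳ++ ls) nothing [])
toEnd-run zero    ls = iterate-done (prim-run refl refl)
toEnd-run (suc n) ls =
  iterate-more (prim-run refl (goRight-at ls (just tick) (ticks n ++ blank)))
    (toEnd-run n (just tick ∷ ls))

-- `1 + n` steps lead to the last cell; each round adds one step to mark its cell and one to unmark
-- it and move on; the final 2 are for meeting the leading blank and returning.
forTime : Bound → Bound
forTime b = const′ 1 ⊕ size ⊕ (size ⊛ (const′ 1 ⊕ (b ⊕ const′ 1)) ⊕ const′ 2)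

module _ {G : Shape} {A : Set} (finA : Finite A) (N : A → Machine (• ⊗ G) A) where

  enter : Machine • Bool
  enter = prim λ { nothing → false , nothing , goRight ; (just _) → true , just mark , stay }

  leave : A → Machine • (A ⊎ A)
  leave a = prim λ _ → inj₁ a , just tick , goLeft

  forStep : A → Bool → Machine (• ⊗ G) (A ⊎ A)
  forStep a false = ret (inj₂ a)
  forStep a true  = bind finA (N a) (λ a′ → on fst′ (leave a′))

  forLoop : A → Machine (• ⊗ G) A
  forLoop = iterate finA (λ a → bind finite-Bool (on fst′ enter) (forStep a))

  -- The counter runs downwards, in the order in which foldr consumes a list.
  forDown : A → Machine (• ⊗ G) A
  forDown a = bind finite-⊤ (on fst′ toEnd) (λ _ → forLoop a)

  -- `Inv i` holds when the rounds for the cells `i - 1` down to `0` are still to come.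
  module _ {n b} (Inv : ℕ → A → ⟦ G ⟧ T → Set)
    (body : ∀ (d : Fin n) {a g} → Inv (suc (toℕ d)) a g → ∃₂ λ a′ g′ →
      (N a ⊢ counter d , g ⟶[ b ] a′ , (counter d , g′)) × Inv (toℕ d) a′ g′) where

    body-at : ∀ {i} → i < n → ∀ {a g} → Inv (suc i) a g → ∃₂ λ a′ g′ →
      (N a ⊢ markedAt n i , g ⟶[ b ] a′ , (markedAt n i , g′)) × Inv i a′ g′
    body-at i<n inv with Fin.fromℕ< i<n | Fin.toℕ-fromℕ< i<n
    ... | d | refl = body d inv

    forLoop-run : ∀ i → i ≤ n → ∀ {a g} → Inv i a g → ∃₂ λ a′ g′ →
      (forLoop a ⊢ beforeCell i (ticks (n ∸ i) ++ blank) , g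
        ⟶[ i * (1 + (b + 1)) + 2 ] a′ , (idle n , g′)) × Inv 0 a′ g′
    forLoop-run zero _ {a} {g} inv = a , g ,
      iterate-done (bind-run (on-run fst′ g (prim-run refl (goRight-idle n))) ret-run) , inv
    forLoop-run (suc i) i<n {a} {g} inv with body-at i<n inv
    ... | a′ , g′ , r , inv′ with forLoop-run i (ℕ.<⇒≤ i<n) inv′
    ...   | a″ , g″ , s , inv″ = a″ , g″ ,
      weaken (ℕ.≤-reflexive (sym (ℕ.+-assoc (1 + (b + 1)) _ 2)))
      (iterate-more (bind-run (on-run fst′ g (prim-run refl refl))
        (bind-run r (on-run fst′ g′ (prim-run refl (trans (goLeft-ticks i (just tick) _)
          (cong (λ k → beforeCell i (ticks k ++ blank)) (sym (ℕ.+-∸-assoc 1 i<n)))))))) s) , inv″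

    forDown-run : ∀ {a g} → Inv n a g → ∃₂ λ a′ g′ →
      (forDown a ⊢ idle n , g ⟶[ 1 + n + (n * (1 + (b + 1)) + 2) ] a′ , (idle n , g′)) × Inv 0 a′ g′
    forDown-run {a} {g} inv with forLoop-run n ℕ.≤-refl inv
    ... | a′ , g′ , r , inv′ = a′ , g′ , bind-run (on-run fst′ g start′) r , inv′
      where
      start′ : toEnd ⊢ idle n ⟶[ suc n ] tt , beforeCell n (ticks (n ∸ n) ++ blank)
      start′ = cast-end
        (trans (cong (λ ls → move goLeft (tape ls nothing [])) (ticks-ʳ++ n blank))
          (trans (goLeft-ticks n nothing [])
            (cong (λ k → beforeCell n (ticks k ++ blank)) (sym (ℕ.n∸n≡0 n)))))
        (toEnd-run n blank)

-- The exact time involves the value `d` of the variable; it is replaced by `n` to get a bound that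
-- depends on the domain size only.
repeatTime : Bound → Bound
repeatTime b = (const′ 2 ⊕ size) ⊕ (size ⊛ (const′ 1 ⊕ (b ⊕ const′ 1)) ⊕ const′ 2)

module _ {G : Shape} (M : Machine G ⊤) where

  atMark : Machine • Bool
  atMark = prim λ { (just (inj₁ stroke)) → false , just tick , stay ; c → true , c , stay }

  advance : Machine • (⊤ ⊎ ⊤)
  advance = prim λ c → inj₁ tt , c , goRight

  repeatStep : Bool → Machine (• ⊗ G) (⊤ ⊎ ⊤)
  repeatStep true  = ret (inj₂ tt)
  repeatStep false = bind finite-⊤ (on snd′ M) (λ _ → on fst′ advance)

  repeatLoop : Machine (• ⊗ G) ⊤
  repeatLoop = iterate finite-⊤ (λ _ → bind finite-Bool (on fst′ atMark) repeatStep) tt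

  -- The distance from the first cell to the mark is the value of the variable, so walking back to
  -- the mark counts the rounds and also restores the tape.
  repeat : Machine (• ⊗ G) ⊤
  repeat = bind finite-⊤ (on fst′ rewind) (λ _ → repeatLoop)

  repeatLoop-run : ∀ {b} i ls rs (g : ℕ → ⟦ G ⟧ T) →
    (∀ j → M ⊢ g j ⟶[ b ] tt , g (suc j)) →
    repeatLoop ⊢ at ls (ticks i ++ just mark ∷ rs) , g 0
      ⟶[ i * (1 + (b + 1)) + 2 ] tt , (tape (ticks i ʳ++ ls) (just mark) rs , g i)
  repeatLoop-run zero ls rs g body =
    iterate-done (bind-run (on-run fst′ (g 0) (prim-run refl refl)) ret-run)
  repeatLoop-run {b} (suc i) ls rs g body = weaken
    (ℕ.≤-reflexive (sym (ℕ.+-assoc (1 + (b + 1)) _ 2)))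
    (iterate-more
      (bind-run (on-run fst′ (g 0) (prim-run refl refl))
        (bind-run (on-run snd′ (tape ls (just tick) (ticks i ++ just mark ∷ rs)) (body 0))
          (on-run fst′ (g 1) (prim-run refl
            (goRight-at ls (just tick) (ticks i ++ just mark ∷ rs))))))
      (repeatLoop-run i (just tick ∷ ls) rs (g ∘ suc) (body ∘ suc)))

  repeat-run : ∀ {n b} (d : Fin n) (g : ℕ → ⟦ G ⟧ T) →
    (∀ j → M ⊢ g j ⟶[ b ] tt , g (suc j)) →
    repeat ⊢ counter d , g 0 ⟶[ (2 + n) + (n * (1 + (b + 1)) + 2) ] tt , (counter d , g (toℕ d))
  repeat-run {n} {b} d g body = weaken
    (ℕ.+-mono-≤ (ℕ.+-monoʳ-≤ 2 d≤n) (ℕ.+-monoˡ-≤ 2 (ℕ.*-monoˡ-≤ (1 + (b + 1)) d≤n)))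
    (bind-run (on-run fst′ (g 0) rewound)
      (cast-end (cong (λ ls → tape ls (just mark) rs , g (toℕ d)) (ticks-ʳ++ (toℕ d) blank))
        (repeatLoop-run (toℕ d) blank rs g body)))
    where
    d≤n = ℕ.<⇒≤ (Fin.toℕ<n d)
    rs = ticks (n ∸ suc (toℕ d)) ++ blank
    map-ticks : ∀ k → map just (List.replicate k tick) ≡ ticks k
    map-ticks k = List.map-replicate just k tick
    rewound : rewind ⊢ counter d ⟶[ 2 + toℕ d ] tt , at blank (ticks (toℕ d) ++ just mark ∷ rs)
    rewound = subst₂ (λ k l → rewind ⊢ tape (l ++ blank) (just mark) rs
        ⟶[ 2 + k ] tt , at blank (ticks (toℕ d) ++ just mark ∷ rs))
      (List.length-replicate (toℕ d)) (map-ticks (toℕ d))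
      (cast-end (cong (at blank)
        (trans (cong (_ʳ++ just mark ∷ rs) (map-ticks (toℕ d))) (ticks-ʳ++ (toℕ d) _)))
        (rewind-run (List.replicate (toℕ d) tick) mark [] rs))

-- Moving to an entry of the encoding

swap : ∀ {F G H} → Focus (F ⊗ (G ⊗ H)) (G ⊗ (F ⊗ H))
swap = record
  { Rest = ∅ ; to = λ (x , y , z) → (y , x , z) , tt ; from = λ ((y , x , z) , _) → x , y , z
  ; to-from = λ _ → refl ; map-from = λ _ _ → refl ; zip-from = λ _ _ _ → refl }

toLeft : ∀ {F G K L} → Focus (F ⊗ (G ⊗ (K ⊗ L))) (F ⊗ (G ⊗ K))
toLeft {L = L} = record
  { Rest = L ; to = λ (x , y , z , w) → (x , y , z) , w
  ; from = λ ((x , y , z) , w) → x , y , z , w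
  ; to-from = λ _ → refl ; map-from = λ _ _ → refl ; zip-from = λ _ _ _ → refl }

toRight : ∀ {F G K L} → Focus (F ⊗ (G ⊗ (K ⊗ L))) (F ⊗ (G ⊗ L))
toRight {K = K} = record
  { Rest = K ; to = λ (x , y , z , w) → (x , y , w) , z
  ; from = λ ((x , y , w) , z) → x , y , z , w
  ; to-from = λ _ → refl ; map-from = λ _ _ → refl ; zip-from = λ _ _ _ → refl }

swapLeft : ∀ {F G K L} → Focus (F ⊗ (G ⊗ (K ⊗ L))) (G ⊗ (F ⊗ K))
swapLeft {L = L} = record
  { Rest = L ; to = λ (x , y , z , w) → (y , x , z) , w
  ; from = λ ((y , x , z) , w) → x , y , z , w
  ; to-from = λ _ → refl ; map-from = λ _ _ → refl ; zip-from = λ _ _ _ → refl }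

swapRight : ∀ {F G K L} → Focus (F ⊗ (G ⊗ (K ⊗ L))) (G ⊗ (F ⊗ L))
swapRight {K = K} = record
  { Rest = K ; to = λ (x , y , z , w) → (y , x , w) , z
  ; from = λ ((y , x , w) , z) → x , y , z , w
  ; to-from = λ _ → refl ; map-from = λ _ _ → refl ; zip-from = λ _ _ _ → refl }

dropSecond : ∀ {F G H} → Focus (F ⊗ (G ⊗ H)) (F ⊗ H)
dropSecond {G = G} = record
  { Rest = G ; to = λ (x , y , z) → (x , z) , y ; from = λ ((x , z) , y) → x , y , z
  ; to-from = λ _ → refl ; map-from = λ _ _ → refl ; zip-from = λ _ _ _ → refl }

dropThird : ∀ {F G H} → Focus (F ⊗ (G ⊗ H)) (F ⊗ G)
dropThird {H = H} = record
  { Rest = H ; to = λ (x , y , z) → (x , y) , z ; from = λ ((x , y) , z) → x , y , z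
  ; to-from = λ _ → refl ; map-from = λ _ _ → refl ; zip-from = λ _ _ _ → refl }

under : ∀ {F G K} → Focus F G → Focus (F ⊗ K) (G ⊗ K)
under f = record
  { Rest     = Rest f
  ; to       = λ (x , k) → (proj₁ (to f x) , k) , proj₂ (to f x)
  ; from     = λ ((g , k) , h) → from f (g , h) , k
  ; to-from  = λ ((g , k) , h) → cong (λ (g , h) → (g , k) , h) (to-from f (g , h))
  ; map-from = λ u ((g , k) , h) → cong (_, _) (map-from f u (g , h))
  ; zip-from = λ u ((g , k) , h) ((g′ , k′) , h′) → cong (_, _) (zip-from f u (g , h) (g′ , h′))
  }

others : ∀ {m} → Fin m → Shape
others {suc m} Fin.zero    = vec m
others         (Fin.suc i) = • ⊗ others i

select : ∀ {m} (i : Fin m) → Focus (vec m) •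
select {suc m} Fin.zero = record
  { Rest = vec m ; to = id ; from = id
  ; to-from = λ _ → refl ; map-from = λ _ _ → refl ; zip-from = λ _ _ _ → refl }
select (Fin.suc i) = let f = select i in record
  { Rest     = • ⊗ Rest f
  ; to       = λ (x , xs) → proj₁ (to f xs) , (x , proj₂ (to f xs))
  ; from     = λ (y , (x , h)) → x , from f (y , h)
  ; to-from  = λ (y , (x , h)) → cong (λ (y , h) → y , (x , h)) (to-from f (y , h))
  ; map-from = λ u (y , (x , h)) → cong (_ ,_) (map-from f u (y , h))
  ; zip-from = λ u (y , (x , h)) (y′ , (x′ , h′)) → cong (_ ,_) (zip-from f u (y , h) (y′ , h′))
  }

environment : ∀ {n m} → Vec (Fin n) m → ⟦ vec m ⟧ T
environment []      = tt
environment (d ∷ θ) = counter d , environment θ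

select-environment : ∀ {n m} (θ : Vec (Fin n) m) i →
  ∃ λ h → environment θ ≡ from (select i) (counter (Vec.lookup θ i) , h)
select-environment (d ∷ θ) Fin.zero    = environment θ , refl
select-environment (d ∷ θ) (Fin.suc i) = let h , eq = select-environment θ i in
  (counter d , h) , cong (counter d ,_) eq

on-variable : ∀ {n m G A} (θ : Vec (Fin n) m) i {M : Machine (• ⊗ G) A} {g b a g′} →
  M ⊢ counter (Vec.lookup θ i) , g ⟶[ b ] a , (counter (Vec.lookup θ i) , g′) →
  on (under (select i)) M ⊢ environment θ , g ⟶[ b ] a , (environment θ , g′)
on-variable θ i {g = g} {g′ = g′} r with select-environment θ i
... | h , eq rewrite eq = on-run (under (select i)) h r

skip : ∀ j → Machine (• ⊗ vec j) ⊤
skip zero    = on fst′ moveRight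
skip (suc j) = on swap (forDown finite-⊤ (λ _ → on snd′ (skip j)) tt)

skipTime : ℕ → Bound
skipTime zero    = const′ 1
skipTime (suc j) = forTime (skipTime j)

skip-run : ∀ n j t → skip j ⊢ t , fill (vec j) (idle n)
  ⟶[ ⟦ skipTime j ⟧ᵇ n ] tt , (rights (n ^ j) t , fill (vec j) (idle n))
skip-run n zero    t = on-run fst′ tt moveRight-run
skip-run n (suc j) t with forDown-run finite-⊤ (λ _ → on snd′ (skip j)) {n} Inv body {tt} start′
  where
  g : ℕ → ⟦ • ⊗ vec j ⟧ T
  g k = rights (k * n ^ j) t , fill (vec j) (idle n)
  Inv : ℕ → ⊤ → ⟦ • ⊗ vec j ⟧ T → Set
  -- With `i` rounds to come, `n - i` blocks of `n ^ j` moves are done.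
  Inv i _ ts = ts ≡ g (n ∸ i)
  start′ : Inv n tt (g 0)
  start′ = cong g (sym (ℕ.n∸n≡0 n))
  body : ∀ (d : Fin n) {a ts} → Inv (suc (toℕ d)) a ts → ∃₂ λ a′ ts′ →
    (on snd′ (skip j) ⊢ counter d , ts ⟶[ ⟦ skipTime j ⟧ᵇ n ] a′ , (counter d , ts′))
    × Inv (toℕ d) a′ ts′
  body d refl = tt , _ , on-run snd′ (counter d) (skip-run n j _) ,
    cong₂ _,_ (trans (sym (rights-+ (n ^ j) _ t))
      (cong (λ k → rights (k * n ^ j) t) (sym (ℕ.+-∸-assoc 1 (Fin.toℕ<n d))))) refl
... | tt , _ , r , refl = on-run swap tt r

seekShape : ∀ {N} → (Fin N → ℕ) → Fin N → Shape
seekShape ar Fin.zero    = ∅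
seekShape ar (Fin.suc P) = vec (ar Fin.zero) ⊗ seekShape (ar ∘ Fin.suc) P

-- Earlier tables are passed by counting, one move for the separator and `skip` for the entries,
-- which follows `sumBefore` literally.
seek : ∀ {N} (ar : Fin N → ℕ) P → Machine (• ⊗ seekShape ar P) ⊤
seek ar Fin.zero    = ret tt
seek ar (Fin.suc P) =
  bind finite-⊤ (on fst′ moveRight) λ _ →
  bind finite-⊤ (on dropThird (skip (ar Fin.zero))) λ _ →
  on dropSecond (seek (ar ∘ Fin.suc) P)

seekTime : ∀ {N} → (Fin N → ℕ) → Fin N → Bound
seekTime ar Fin.zero    = const′ 1
seekTime ar (Fin.suc P) = const′ 1 ⊕ (skipTime (ar Fin.zero) ⊕ seekTime (ar ∘ Fin.suc) P)

seek-run : ∀ {N} n (ar : Fin N → ℕ) P t → seek ar P ⊢ t , fill (seekShape ar P) (idle n)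
  ⟶[ ⟦ seekTime ar P ⟧ᵇ n ] tt ,
  (rights (sumBefore (λ Q → suc (n ^ ar Q)) P) t , fill (seekShape ar P) (idle n))
seek-run n ar Fin.zero    t = ret-run
seek-run n ar (Fin.suc P) t = cast-end (cong (_, _) same)
  (bind-run (on-run fst′ _ moveRight-run)
    (bind-run (on-run dropThird _ (skip-run n (ar Fin.zero) _))
      (on-run dropSecond _ (seek-run n (ar ∘ Fin.suc) P _))))
  where
  k = sumBefore (λ Q → suc (n ^ ar (Fin.suc Q))) P
  same : rights k (rights (n ^ ar Fin.zero) (rights 1 t)) ≡ rights (suc (n ^ ar Fin.zero) + k) t
  same = begin
    rights k (rights (n ^ ar Fin.zero) (rights 1 t))
      ≡⟨ cong (rights k) (rights-+ (n ^ ar Fin.zero) 1 t) ⟨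
    rights k (rights (n ^ ar Fin.zero + 1) t)        ≡⟨ rights-+ k _ t ⟨
    rights (k + (n ^ ar Fin.zero + 1)) t
      ≡⟨ cong (λ l → rights l t) (trans (ℕ.+-comm k _) (cong (_+ k) (ℕ.+-comm _ 1))) ⟩
    rights (suc (n ^ ar Fin.zero) + k) t             ∎
    where open ≡-Reasoning

walk : ∀ {m k} → Vec (Fin m) k → Machine (• ⊗ (vec m ⊗ vec k)) ⊤
walk []               = ret tt
walk {k = suc k} (x ∷ xs) =
  bind finite-⊤ (on swapRight (on (under (select x)) (repeat (skip k)))) λ _ →
  on toRight (walk xs)

walkTime : ℕ → Bound
walkTime zero    = const′ 1
walkTime (suc k) = repeatTime (skipTime k) ⊕ walkTime k

walk-run : ∀ {n m k} (θ : Vec (Fin n) m) (xs : Vec (Fin m) k) t →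
  walk xs ⊢ t , environment θ , fill (vec k) (idle n) ⟶[ ⟦ walkTime k ⟧ᵇ n ] tt ,
    (rights (index (Vec.map (Vec.lookup θ) xs)) t , environment θ , fill (vec k) (idle n))
walk-run θ [] t = ret-run
walk-run {n} {k = suc k} θ (x ∷ xs) t = cast-end
  (cong (_, _) (trans (sym (rights-+ (index (Vec.map (Vec.lookup θ) xs)) (toℕ d * n ^ k) t))
    (cong (λ l → rights l t) (ℕ.+-comm _ (toℕ d * n ^ k)))))
  (bind-run
    (on-run _ _ (on-variable θ x (repeat-run _ d
      (λ j → rights (j * n ^ k) t , fill (vec k) (idle n))
      (λ j → cast-end (cong (_, _) (sym (rights-+ (n ^ k) (j * n ^ k) t))) (skip-run n k _)))))
    (on-run _ _ (walk-run θ xs _)))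
  where d = Vec.lookup θ x

-- Reading and changing one symbol of a word

module _ {A : Set} {xs : List A} {x : A} {offset : ℕ}
  (s : Split xs x offset (_≢ x)) (tail : List Cell) where

  written : (A → Symb) → T
  written h = at blank (map just (map h xs) ++ tail)

  -- The head stands on the cell of `x`, whose content `y` is independent of `h`: this describes the
  -- tape before and after overwriting.
  opened : (A → Symb) → Symb → T
  opened h y = tape (map just (map h (before s)) ʳ++ blank) (just y)
    (map just (map h (after s)) ++ tail)

  written-split : ∀ h → written h ≡
    at blank (map just (map h (before s)) ++ just (h x) ∷ map just (map h (after s)) ++ tail)
  written-split h = cong (at blank) (begin
    map just (map h xs) ++ tail
      ≡⟨ cong (λ l → map just (map h l) ++ tail) (split s) ⟩
    map just (map h (before s ++ x ∷ after s)) ++ tail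
      ≡⟨ cong (λ l → map just l ++ tail) (List.map-++ h (before s) _) ⟩
    map just (map h (before s) ++ h x ∷ map h (after s)) ++ tail
      ≡⟨ cong (_++ tail) (List.map-++ just (map h (before s)) _) ⟩
    (map just (map h (before s)) ++ just (h x) ∷ map just (map h (after s))) ++ tail
      ≡⟨ List.++-assoc (map just (map h (before s))) _ tail ⟩
    map just (map h (before s)) ++ just (h x) ∷ map just (map h (after s)) ++ tail ∎)
    where open ≡-Reasoning

  rights-written : ∀ h → rights offset (written h) ≡ opened h (h x)
  rights-written h = begin
    rights offset (written h)
      ≡⟨ cong₂ rights (sym len) (written-split h) ⟩
    rights (length l) (at blank (l ++ just (h x) ∷ map just (map h (after s)) ++ tail))
      ≡⟨ rights-at blank l _ ⟩
    opened h (h x) ∎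
    where
    open ≡-Reasoning
    l = map just (map h (before s))
    len : length l ≡ offset
    len = trans (List.length-map just (map h (before s)))
      (trans (List.length-map h (before s)) (length-before s))

  -- Off the cell of `x` the two labellings agree, so once `h′ x` is written there the whole tape is
  -- labelled by `h′`.
  rewind-opened : ∀ h h′ → (∀ y → y ≢ x → h y ≡ h′ y) →
    rewind ⊢ opened h (h′ x) ⟶[ 2 + length xs ] tt , written h′
  rewind-opened h h′ same = weaken (ℕ.+-monoʳ-≤ 2 len)
    (cast-end (trans (cong₂ (λ l r → at blank (map just l ++ just (h′ x) ∷ map just r ++ tail))
        (List.map-cong-local (All.map (same _) (before-other s)))
        (List.map-cong-local (All.map (same _) (after-other s))))
      (sym (written-split h′)))
      (rewind-back (map h (before s)) (h′ x) [] _))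
    where
    len : length (map h (before s)) ≤ length xs
    len = ℕ.≤-trans (ℕ.≤-reflexive (List.length-map h (before s)))
      (ℕ.≤-trans (List.length-++-≤ˡ (before s)) (ℕ.≤-reflexive (cong length (sym (split s)))))

home : ∀ {σ n} → Structure σ n → List Cell → T
home {σ} {n} I tail = at blank (map just (map (inj₁ ∘ letter I) (slots σ n)) ++ tail)

accessShape : ∀ σ → Symbol σ → Shape
accessShape σ P = vec 1 ⊗ (seekShape (arity σ) P ⊗ vec (arity σ P))

accessTime : ∀ σ → Symbol σ → Bound
accessTime σ P = skipTime 1 ⊕ (seekTime (arity σ) P ⊕ (const′ 1 ⊕ (walkTime (arity σ P) ⊕
  (const′ 1 ⊕ ((const′ 2 ⊕ slotsBound σ) ⊕ const′ 1)))))

module _ {σ : Vocabulary} (P : Symbol σ) {m : ℕ} (xs : Vec (Fin m) (arity σ P))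
  (f : Four → Four) where

  modify : Machine • Four
  modify = prim λ { (just (inj₁ (value v))) → v , just (inj₁ (value (f v))) , stay
                  -- A default; in `access-run` the head stands on a truth value here.
                  ; c                       → 𝐮 , c , stay }

  -- Returns the old value of the entry.
  access : Machine (• ⊗ (vec m ⊗ accessShape σ P)) Four
  access =
    -- `n ^ 1` moves pass the strokes; the single move after `seek` passes the separator of `P`.
    bind finite-⊤ (on toStrokes (skip 1)) λ _ →
    bind finite-⊤ (on toSeek (seek (arity σ) P)) λ _ →
    bind finite-⊤ (on fst′ moveRight) λ _ →
    bind finite-⊤ (on toWalk (walk xs)) λ _ →
    bind finite-Four (on fst′ modify) λ v →
    bind finite-⊤ (on fst′ rewind) λ _ →
    ret v
    where
    toStrokes : ∀ {F G K L} → Focus (F ⊗ (G ⊗ (K ⊗ L))) (F ⊗ K)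
    toStrokes {G = G} {L = L} = record
      { Rest = G ⊗ L ; to = λ (x , y , z , w) → (x , z) , (y , w)
      ; from = λ ((x , z) , (y , w)) → x , y , z , w
      ; to-from = λ _ → refl ; map-from = λ _ _ → refl ; zip-from = λ _ _ _ → refl }
    toSeek : ∀ {F G K L M} → Focus (F ⊗ (G ⊗ (K ⊗ (L ⊗ M)))) (F ⊗ L)
    toSeek {G = G} {K} {M = M} = record
      { Rest = G ⊗ (K ⊗ M) ; to = λ (x , y , z , w , v) → (x , w) , (y , z , v)
      ; from = λ ((x , w) , (y , z , v)) → x , y , z , w , v
      ; to-from = λ _ → refl ; map-from = λ _ _ → refl ; zip-from = λ _ _ _ → refl }
    toWalk : ∀ {F G K L M} → Focus (F ⊗ (G ⊗ (K ⊗ (L ⊗ M)))) (F ⊗ (G ⊗ M))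
    toWalk {K = K} {L} = record
      { Rest = K ⊗ L ; to = λ (x , y , z , w , v) → (x , y , v) , (z , w)
      ; from = λ ((x , y , v) , (z , w)) → x , y , z , w , v
      ; to-from = λ _ → refl ; map-from = λ _ _ → refl ; zip-from = λ _ _ _ → refl }

  -- Reading is the case where `f` is `id` and `J` is `I`; firing a rule is the case where `f` joins
  -- the literal's value.
  access-run : ∀ {n} (θ : Vec (Fin n) m) tail {I J : Structure σ n} {ds} →
    Vec.map (Vec.lookup θ) xs ≡ ds → J P ds ≡ f (I P ds) →
    (∀ s → s ≢ entry P ds → letter I s ≡ letter J s) →
    access ⊢ home I tail , environment θ , fill (accessShape σ P) (idle n)
      ⟶[ ⟦ accessTime σ P ⟧ᵇ n ] I P ds ,
      (home J tail , environment θ , fill (accessShape σ P) (idle n))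
  access-run {n} θ tail {I} {J} {ds} refl new same =
    bind-run (on-run _ _ (skip-run n 1 (home I tail)))
      (bind-run (on-run _ _ (seek-run n (arity σ) P _))
        (bind-run (on-run fst′ _ moveRight-run)
          (bind-run (on-run _ _ (cast-end (cong (_, _) arrived) (walk-run θ xs _)))
            (bind-run (on-run fst′ _ (prim-run refl refl))
              (bind-run (on-run fst′ _ back) ret-run)))))
    where
    s = slots-split P ds
    k = sumBefore (tableLength σ n) P
    t = home I tail
    arrived : rights (index ds) (rights 1 (rights k (rights (n ^ 1) t))) ≡
      opened s tail (inj₁ ∘ letter I) (inj₁ (value (I P ds)))
    arrived = begin
      rights (index ds) (rights 1 (rights k (rights (n ^ 1) t)))
        ≡⟨ cong (λ u → rights (index ds) (rights 1 u)) (rights-+ k (n ^ 1) t) ⟨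
      rights (index ds) (rights (suc (k + n ^ 1)) t)
        ≡⟨ rights-+ (index ds) _ t ⟨
      rights (index ds + suc (k + n ^ 1)) t
        ≡⟨ cong (λ l → rights l t) (offset (index ds) k n) ⟩
      rights (n + (k + suc (index ds))) t
        ≡⟨ rights-written s tail (inj₁ ∘ letter I) ⟩
      opened s tail (inj₁ ∘ letter I) (inj₁ (value (I P ds))) ∎
      where
      open ≡-Reasoning
      open import Data.Nat.Solver
      open +-*-Solver
      -- `n ^ 1` unfolds to `n * 1`.
      offset : ∀ i k n → i + suc (k + n * 1) ≡ n + (k + suc i)
      offset = solve 3 (λ i k n →
        i :+ (con 1 :+ (k :+ n :* con 1)) := n :+ (k :+ (con 1 :+ i))) refl
    back : rewind ⊢ opened s tail (inj₁ ∘ letter I) (inj₁ (value (f (I P ds))))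
      ⟶[ 2 + ⟦ slotsBound σ ⟧ᵇ n ] tt , home J tail
    back = subst₂
      (λ v l → rewind ⊢ opened s tail (inj₁ ∘ letter I) (inj₁ (value v)) ⟶[ 2 + l ] tt , home J tail)
      new (length-slots σ n)
      (rewind-opened s tail (inj₁ ∘ letter I) (inj₁ ∘ letter J) (λ y y≢ → cong inj₁ (same y y≢)))

-- Comparing the values of two variables

visitTime : Bound
visitTime = repeatTime (const′ 1) ⊕ (const′ 1 ⊕ ((const′ 2 ⊕ size) ⊕ const′ 1))

fromFin : ∀ {n} (d : Fin n) → Split (allFin n) d (toℕ d) (_≢ d)
fromFin d = tabulate-split id d λ _ j≢d → j≢d

wordTape : ∀ {n} → (Fin n → Symb) → T
wordTape {n} h = at blank (map just (map h (allFin n)) ++ blank)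

module _ {m : ℕ} where

  visit : ∀ {A} → Finite A → Fin m → (Symb → A × Symb) → Machine (vec m ⊗ •) A
  visit finA x p =
    bind finite-⊤ (on (under (select x)) (repeat moveRight)) λ _ →
    bind finA (on snd′ (prim λ { nothing  → proj₁ (p tick) , nothing , stay
                               ; (just y) → proj₁ (p y) , just (proj₂ (p y)) , stay })) λ a →
    bind finite-⊤ (on snd′ rewind) λ _ →
    ret a

  visit-run : ∀ {A n} (finA : Finite A) (θ : Vec (Fin n) m) x (p : Symb → A × Symb) {h h′} →
    let d = Vec.lookup θ x in
    h′ d ≡ proj₂ (p (h d)) → (∀ e → e ≢ d → h e ≡ h′ e) →
    visit finA x p ⊢ environment θ , wordTape h ⟶[ ⟦ visitTime ⟧ᵇ n ] proj₁ (p (h d)) ,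
      (environment θ , wordTape h′)
  visit-run {n = n} finA θ x p {h} {h′} new same =
    bind-run (on-variable θ x (cast-end (cong (counter d ,_) (rights-written (fromFin d) blank h))
        (repeat-run _ d (λ j → rights j (wordTape h)) (λ j → moveRight-run))))
      (bind-run (on-run snd′ _ (prim-run refl refl))
        (bind-run (on-run snd′ _ back) ret-run))
    where
    d = Vec.lookup θ x
    back : rewind ⊢ opened (fromFin d) blank h (proj₂ (p (h d))) ⟶[ 2 + n ] tt , wordTape h′
    back = subst₂ (λ y l → rewind ⊢ opened (fromFin d) blank h y ⟶[ 2 + l ] tt , wordTape h′)
      new (List.length-tabulate {n = n} id) (rewind-opened (fromFin d) blank h h′ same)

wordTape-tick : ∀ n → wordTape {n} (const tick) ≡ idle n
wordTape-tick n = cong (λ w → at blank (w ++ blank))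
  (trans (cong (map just) (ticks′ n id)) (List.map-replicate just n tick))
  where
  ticks′ : ∀ n {A : Set} (f : Fin n → A) → map (const tick) (tabulate f) ≡ List.replicate n tick
  ticks′ zero    f = refl
  ticks′ (suc n) f = cong (tick ∷_) (ticks′ n (f ∘ Fin.suc))

isMark : Symb → Bool
isMark (inj₁ separator) = true
isMark _                = false

module _ {m : ℕ} (x y : Fin m) where

  -- Marking the cell of `x` on a scratch tape makes its position visible to a later visit at `y`.
  -- Visiting in turn also covers `x` and `y` being the same variable, with one tape and one head.
  equal : Machine (vec m ⊗ •) Bool
  equal =
    bind finite-⊤ (visit finite-⊤ x (λ _ → tt , mark)) λ _ →
    bind finite-Bool (visit finite-Bool y (λ s → isMark s , s)) λ b →
    bind finite-⊤ (visit finite-⊤ x (λ _ → tt , tick)) λ _ →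
    ret b

  equalTime : Bound
  equalTime = visitTime ⊕ (visitTime ⊕ (visitTime ⊕ const′ 1))

  equal-run : ∀ {n} (θ : Vec (Fin n) m) →
    equal ⊢ environment θ , idle n ⟶[ ⟦ equalTime ⟧ᵇ n ]
      does (Vec.lookup θ x Fin.≟ Vec.lookup θ y) , (environment θ , idle n)
  equal-run {n} θ = subst₂
    (λ t b → equal ⊢ environment θ , t ⟶[ ⟦ equalTime ⟧ᵇ n ] b , (environment θ , t))
    (wordTape-tick n) (isMark-marked (Vec.lookup θ y))
    (bind-run (visit-run finite-⊤ θ x (λ _ → tt , mark) {const tick} {marked} new same)
      (bind-run (visit-run finite-Bool θ y (λ s → isMark s , s) {marked} {marked} refl λ _ _ → refl)
        (bind-run (visit-run finite-⊤ θ x (λ _ → tt , tick) {marked} {const tick} refl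
            λ e e≢d → sym (same e e≢d))
          ret-run)))
    where
    d = Vec.lookup θ x
    marked : Fin n → Symb
    marked e = if does (d Fin.≟ e) then mark else tick
    new : marked d ≡ mark
    new = cong (if_then mark else tick) (dec-true (d Fin.≟ d) refl)
    same : ∀ e → e ≢ d → tick ≡ marked e
    same e e≢d = cong (if_then mark else tick) (sym (dec-false (d Fin.≟ e) (e≢d ∘ sym)))
    isMark-marked : ∀ e → isMark (marked e) ≡ does (d Fin.≟ e)
    isMark-marked e with does (d Fin.≟ e)
    ... | true  = refl
    ... | false = refl

-- Evaluation of formulas

-- Every subformula owns its work tapes and leaves them idle.
workShape : ∀ {σ m} → Formula σ m → Shape
workShape {σ} (atom P xs) = accessShape σ P
workShape (x ≐ y)         = •
workShape (not φ)         = workShape φ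
workShape (φ and ψ)       = workShape φ ⊗ workShape ψ
workShape (φ or ψ)        = workShape φ ⊗ workShape ψ
workShape (all′ φ)        = • ⊗ workShape φ
workShape (ex′ φ)         = • ⊗ workShape φ

thirdFirst : ∀ {F G K L} → Focus (F ⊗ (G ⊗ (K ⊗ L))) (K ⊗ (F ⊗ (G ⊗ L)))
thirdFirst = record
  { Rest = ∅ ; to = λ (x , y , z , w) → (z , x , y , w) , tt
  ; from = λ ((z , x , y , w) , _) → x , y , z , w
  ; to-from = λ _ → refl ; map-from = λ _ _ → refl ; zip-from = λ _ _ _ → refl }

bindVariable : ∀ {m F L} → Focus (• ⊗ (F ⊗ (vec m ⊗ L))) (F ⊗ (vec (suc m) ⊗ L))
bindVariable = record
  { Rest = ∅ ; to = λ (z , x , y , w) → (x , (z , y) , w) , tt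
  ; from = λ ((x , (z , y) , w) , _) → z , x , y , w
  ; to-from = λ _ → refl ; map-from = λ _ _ → refl ; zip-from = λ _ _ _ → refl }

fromBool : Bool → Four
fromBool true  = 𝐭
fromBool false = 𝐟

module _ {m} {H : Shape} (_∙_ : Four → Four → Four) (e : Four)
  (M : Machine (• ⊗ (vec (suc m) ⊗ H)) Four) where

  foldStep : Four → Machine (• ⊗ (• ⊗ (vec m ⊗ H))) Four
  foldStep v = bind finite-Four (on bindVariable M) λ w → ret (w ∙ v)

  -- The accumulator is a truth value and stays in the finite control; the loop counter, marked at
  -- the current cell, is itself the tape of the bound variable.
  fold : Machine (• ⊗ (vec m ⊗ (• ⊗ H))) Four
  fold = on thirdFirst (forDown finite-Four foldStep e)

  fold-run : ∀ {n b} (θ : Vec (Fin n) m) t h (f : Fin n → Four) →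
    (∀ d → M ⊢ t , environment (d ∷ θ) , h ⟶[ b ] f d , (t , environment (d ∷ θ) , h)) →
    fold ⊢ t , environment θ , idle n , h
      ⟶[ 1 + n + (n * (1 + ((b + 1) + 1)) + 2) ] foldr _∙_ e (map f (allFin n)) ,
      (t , environment θ , idle n , h)
  fold-run {n} {b} θ t h f body with forDown-run finite-Four foldStep {n} Inv step′ {e} {ts} start′
    where
    ts = t , environment θ , h
    Inv : ℕ → Four → ⟦ • ⊗ (vec m ⊗ H) ⟧ T → Set
    -- The elements from `i` on are already folded in, since the loop counts down.
    Inv i v us = us ≡ ts × v ≡ foldr _∙_ e (map f (drop i (allFin n)))
    drop-tabulate : ∀ {A : Set} {k} (g : Fin k → A) (d : Fin k) →
      drop (toℕ d) (tabulate g) ≡ g d ∷ drop (suc (toℕ d)) (tabulate g)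
    drop-tabulate g Fin.zero    = refl
    drop-tabulate g (Fin.suc d) = drop-tabulate (g ∘ Fin.suc) d
    drop-end : ∀ {A : Set} k (g : Fin k → A) → drop k (tabulate g) ≡ []
    drop-end zero    g = refl
    drop-end (suc k) g = drop-end k (g ∘ Fin.suc)
    start′ : Inv n e ts
    start′ = refl , cong (foldr _∙_ e ∘ map f) (sym (drop-end n id))
    step′ : ∀ (d : Fin n) {v us} → Inv (suc (toℕ d)) v us → ∃₂ λ v′ us′ →
      (foldStep v ⊢ counter d , us ⟶[ b + 1 ] v′ , (counter d , us′)) × Inv (toℕ d) v′ us′
    step′ d (refl , refl) = _ , ts , bind-run (on-run bindVariable tt (body d)) ret-run ,
      refl , cong (foldr _∙_ e ∘ map f) (sym (drop-tabulate id d))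
  ... | _ , _ , r , refl , refl = on-run thirdFirst tt r

foldTime : Bound → Bound
foldTime b = forTime (b ⊕ const′ 1)

evaluate : ∀ {σ m} (φ : Formula σ m) → Machine (• ⊗ (vec m ⊗ workShape φ)) Four
evaluate {σ} (atom P xs) = access {σ} P xs id
evaluate (x ≐ y)     = bind finite-Bool (on snd′ (equal x y)) λ b → ret (fromBool b)
evaluate (not φ)     = bind finite-Four (evaluate φ) λ v → ret (inverse v)
evaluate (φ and ψ)   =
  bind finite-Four (on toLeft (evaluate φ)) λ v →
  bind finite-Four (on toRight (evaluate ψ)) λ w → ret (v ∧t w)
evaluate (φ or ψ)    =
  bind finite-Four (on toLeft (evaluate φ)) λ v →
  bind finite-Four (on toRight (evaluate ψ)) λ w → ret (v ∨t w)
evaluate (all′ φ)    = fold _∧t_ 𝐭 (evaluate φ)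
evaluate (ex′ φ)     = fold _∨t_ 𝐟 (evaluate φ)

evaluateTime : ∀ {σ m} → Formula σ m → Bound
evaluateTime {σ} (atom P xs) = accessTime σ P
evaluateTime (x ≐ y)     = equalTime x y ⊕ const′ 1
evaluateTime (not φ)     = evaluateTime φ ⊕ const′ 1
evaluateTime (φ and ψ)   = evaluateTime φ ⊕ (evaluateTime ψ ⊕ const′ 1)
evaluateTime (φ or ψ)    = evaluateTime φ ⊕ (evaluateTime ψ ⊕ const′ 1)
evaluateTime (all′ φ)    = foldTime (evaluateTime φ)
evaluateTime (ex′ φ)     = foldTime (evaluateTime φ)

evaluate-run : ∀ {σ m n} (φ : Formula σ m) (I : Structure σ n) tail (θ : Vec (Fin n) m) →
  let ts = home I tail , environment θ , fill (workShape φ) (idle n) in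
  evaluate φ ⊢ ts ⟶[ ⟦ evaluateTime φ ⟧ᵇ n ] eval I θ φ , ts
evaluate-run {σ} (atom P xs) I tail θ = access-run {σ} P xs id θ tail refl refl λ _ _ → refl
evaluate-run {σ} {n = n} (x ≐ y) I tail θ =
  subst (λ v → evaluate {σ} (x ≐ y) ⊢ ts ⟶[ ⟦ evaluateTime {σ} (x ≐ y) ⟧ᵇ n ] v , ts) value≡
    (bind-run (on-run snd′ (home I tail) (equal-run x y θ)) ret-run)
  where
  ts = home I tail , environment θ , idle n
  value≡ : fromBool (does (Vec.lookup θ x Fin.≟ Vec.lookup θ y)) ≡ eval I θ (x ≐ y)
  value≡ with Vec.lookup θ x Fin.≟ Vec.lookup θ y
  ... | yes _ = refl
  ... | no  _ = refl
evaluate-run (not φ) I tail θ = bind-run (evaluate-run φ I tail θ) ret-run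
evaluate-run (φ and ψ) I tail θ =
  bind-run (on-run toLeft _ (evaluate-run φ I tail θ))
    (bind-run (on-run toRight _ (evaluate-run ψ I tail θ)) ret-run)
evaluate-run (φ or ψ) I tail θ =
  bind-run (on-run toLeft _ (evaluate-run φ I tail θ))
    (bind-run (on-run toRight _ (evaluate-run ψ I tail θ)) ret-run)
evaluate-run (all′ φ) I tail θ =
  fold-run _∧t_ 𝐭 (evaluate φ) θ _ _ _ λ d → evaluate-run φ I tail (d ∷ θ)
evaluate-run (ex′ φ) I tail θ =
  fold-run _∨t_ 𝐟 (evaluate φ) θ _ _ _ λ d → evaluate-run φ I tail (d ∷ θ)

-- Firing rules, sweeps and saturation

open INF

module _ {σ : Vocabulary} {n : ℕ} where

  update : Structure σ n → ∀ P → Vec (Fin n) (arity σ P) → Four → Structure σ n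
  update I P ds v Q es with P Fin.≟ Q
  ... | no _ = I Q es
  ... | yes refl with Vec.≡-dec Fin._≟_ ds es
  ...   | yes _ = v
  ...   | no _  = I P es

  update-same : ∀ I P ds v → update I P ds v P ds ≡ v
  update-same I P ds v with P Fin.≟ P
  ... | no P≢P = contradiction refl P≢P
  ... | yes refl with Vec.≡-dec Fin._≟_ ds ds
  ...   | yes _   = refl
  ...   | no ds≢ = contradiction refl ds≢

  update-other : ∀ I P ds v s → s ≢ entry P ds → letter I s ≡ letter (update I P ds v) s
  update-other I P ds v unit         _ = refl
  update-other I P ds v (sep Q)      _ = refl
  update-other I P ds v (entry Q es) s≢ with P Fin.≟ Q
  ... | no _ = refl
  ... | yes refl with Vec.≡-dec Fin._≟_ ds es
  ...   | yes refl = contradiction refl s≢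
  ...   | no _     = refl

  update-above : ∀ I P ds v → I P ds ≤p v → I ≤ˢ update I P ds v
  update-above I P ds v le Q es with P Fin.≟ Q
  ... | no _ = reflₚ
  ... | yes refl with Vec.≡-dec Fin._≟_ ds es
  ...   | yes refl = le
  ...   | no _     = reflₚ

  -- At `ds` the two structures agree, and elsewhere the propagator can only add precision. Thus
  -- raising one entry is an admissible step for `reaches-step`.
  update-below : ∀ I φ ds → 𝐭 ≤p eval I ds (body φ) →
    update I (head φ) ds (literalValue (sign φ) ⊔p I (head φ) ds) ≤ˢ propagator φ I
  update-below I φ ds fires Q es with head φ Fin.≟ Q
  ... | no _ = reflₚ
  ... | yes refl with Vec.≡-dec Fin._≟_ ds es | 𝐭 ≤p? eval I es (body φ)
  ...   | yes refl | yes _     = reflₚ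
  ...   | yes refl | no ¬fires = contradiction fires ¬fires
  ...   | no _     | yes _     = y≤x⊔y _ _
  ...   | no _     | no _      = reflₚ

  Stable : INF σ → Structure σ n → Set
  Stable φ I = ∀ ds → 𝐭 ≤p eval I ds (body φ) →
    literalValue (sign φ) ⊔p I (head φ) ds ≡ I (head φ) ds

  stable⇒fixed : ∀ {φ I} → Stable φ I → propagator φ I ≤ˢ I
  stable⇒fixed {φ} {I} stable Q ds with head φ Fin.≟ Q
  ... | no _ = reflₚ
  ... | yes refl with 𝐭 ≤p? eval I ds (body φ)
  ...   | yes fires = ≤p-reflexive (stable ds fires)
  ...   | no _      = reflₚ

module _ {σ : Vocabulary} (V : List (INF σ)) where

  module _ {n : ℕ} where

    -- `C` is claimed only if nothing changed: a change may make rules fire at tuples checked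
    -- before. Without changes the structure is the same throughout, so the conditions of successive
    -- passes hold together.
    data Outcome (C : Structure σ n → Set) (I : Structure σ n) : Bool → Structure σ n → Set where
      unchanged : C I → Outcome C I false I
      changed   : ∀ {J} → Reaches V I J → totalDeficit J < totalDeficit I → Outcome C I true J

    outcome-∨ : ∀ {C D I J K b c} → Outcome C I b J → Outcome D J c K →
      Outcome (λ I → C I × D I) I (b ∨ c) K
    outcome-∨ (unchanged c)  (unchanged d)   = unchanged (c , d)
    outcome-∨ (unchanged _)  (changed r lt)  = changed r lt
    outcome-∨ (changed r lt) (unchanged _)   = changed r lt
    outcome-∨ (changed r lt) (changed r′ lt′) = changed (reaches-trans V r r′) (ℕ.<-trans lt′ lt)

    outcome-map : ∀ {C D : Structure σ n → Set} {I J b} → (∀ {I} → C I → D I) →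
      Outcome C I b J → Outcome D I b J
    outcome-map f (unchanged c)  = unchanged (f c)
    outcome-map f (changed r lt) = changed r lt

  module _ (φ : INF σ) where

    private k = arity σ (head φ)

    ruleShape : Shape
    ruleShape = vec k ⊗ (workShape (body φ) ⊗ accessShape σ (head φ))

    raise : Four → Four
    raise = literalValue (sign φ) ⊔p_

    fireIf : ∀ {v} → Dec (𝐭 ≤p v) →
      Machine (vec k ⊗ (• ⊗ (workShape (body φ) ⊗ accessShape σ (head φ)))) Bool
    fireIf (no _)  = ret false
    fireIf (yes _) =
      bind finite-Four (on swapRight (access {σ} (head φ) (Vec.allFin k) raise)) λ v →
      -- `v` is the value before the access, so this reports whether the entry grew.
      ret (notᵇ (does (raise v ≟⁴ v)))

    fire : Machine (vec k ⊗ (• ⊗ (workShape (body φ) ⊗ accessShape σ (head φ)))) Bool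
    fire = bind finite-Four (on swapLeft (evaluate (body φ))) λ v → fireIf (𝐭 ≤p? v)

    fireTime : Bound
    fireTime = evaluateTime (body φ) ⊕ (accessTime σ (head φ) ⊕ const′ 1)

    module _ {n : ℕ} (tail : List Cell) where

      state : Structure σ n → ⟦ • ⊗ (workShape (body φ) ⊗ accessShape σ (head φ)) ⟧ T
      state I =
        home I tail , fill (workShape (body φ)) (idle n) , fill (accessShape σ (head φ)) (idle n)

      StableAt : Vec (Fin n) k → Structure σ n → Set
      StableAt ds I = 𝐭 ≤p eval I ds (body φ) → raise (I (head φ) ds) ≡ I (head φ) ds

      fireIf-run : φ ∈ V → ∀ ds I (fires? : Dec (𝐭 ≤p eval I ds (body φ))) → ∃₂ λ b J →
        (fireIf fires? ⊢ environment ds , state I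
          ⟶[ ⟦ accessTime σ (head φ) ⊕ const′ 1 ⟧ᵇ n ] b , (environment ds , state J))
        × Outcome (StableAt ds) I b J
      fireIf-run φ∈V ds I (no ¬fires) = false , I ,
        weaken (ℕ.m≤n+m 1 (⟦ accessTime σ (head φ) ⟧ᵇ n)) ret-run ,
        unchanged λ fires → contradiction fires ¬fires
      fireIf-run φ∈V ds I (yes fires) with raise (I (head φ) ds) ≟⁴ I (head φ) ds in eq
      ... | yes same = false , I ,
        cast-result (cong (notᵇ ∘ does) eq)
          (bind-run (on-run _ _ (access-run {σ} (head φ) (Vec.allFin k) raise ds tail {I} {I}
            (Vec.map-lookup-allFin ds) (sym same) λ _ _ → refl)) ret-run) ,
        unchanged λ _ → same
      ... | no differs = true , J ,
        cast-result (cong (notᵇ ∘ does) eq)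
          (bind-run (on-run _ _ (access-run {σ} (head φ) (Vec.allFin k) raise ds tail {I} {J}
            (Vec.map-lookup-allFin ds) new (update-other I (head φ) ds _))) ret-run) ,
        changed (reaches-step V (propagator∈ V φ∈V) I≤J (update-below I φ ds fires))
          (totalDeficit-strict I≤J (head φ) ds λ I≡J → differs (sym (trans I≡J new)))
        where
        J = update I (head φ) ds (raise (I (head φ) ds))
        new = update-same I (head φ) ds (raise (I (head φ) ds))
        I≤J = update-above I (head φ) ds _ (y≤x⊔y (literalValue (sign φ)) _)

      fire-run : φ ∈ V → ∀ ds I → ∃₂ λ b J →
        (fire ⊢ environment ds , state I ⟶[ ⟦ fireTime ⟧ᵇ n ] b , (environment ds , state J))
        × Outcome (StableAt ds) I b J
      fire-run φ∈V ds I with fireIf-run φ∈V ds I (𝐭 ≤p? eval I ds (body φ))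
      ... | b , J , r , outcome = b , J ,
        bind-run (on-run swapLeft _ (evaluate-run (body φ) I tail ds)) r , outcome

  toHead : ∀ {F G K} → Focus ((F ⊗ G) ⊗ K) (F ⊗ (G ⊗ K))
  toHead = record
    { Rest = ∅ ; to = λ ((x , y) , z) → (x , y , z) , tt ; from = λ ((x , y , z) , _) → (x , y) , z
    ; to-from = λ _ → refl ; map-from = λ _ _ → refl ; zip-from = λ _ _ _ → refl }

  collect : ∀ {F G K} → Focus (G ⊗ (F ⊗ K)) ((F ⊗ G) ⊗ K)
  collect = record
    { Rest = ∅ ; to = λ (y , x , z) → ((x , y) , z) , tt ; from = λ (((x , y) , z) , _) → y , x , z
    ; to-from = λ _ → refl ; map-from = λ _ _ → refl ; zip-from = λ _ _ _ → refl }

  mutual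

    -- For the inner loops the outer counter is part of the state that they carry along; `collect`
    -- returns it to `M` as its first variable.
    forTuples : ∀ j {G} → Machine (vec j ⊗ G) Bool → Machine (vec j ⊗ G) Bool
    forTuples zero    M = M
    forTuples (suc j) M = on toHead (forDown finite-Bool (tupleStep j M) false)

    tupleStep : ∀ j {G} → Machine (vec (suc j) ⊗ G) Bool → Bool → Machine (• ⊗ (vec j ⊗ G)) Bool
    tupleStep j M b = bind finite-Bool (on swap (forTuples j (on collect M))) λ c → ret (b ∨ c)

  tuplesTime : ℕ → Bound → Bound
  tuplesTime zero    b = b
  tuplesTime (suc j) b = forTime (tuplesTime j b ⊕ const′ 1)

  forTuples-run : ∀ j {G n b} (M : Machine (vec j ⊗ G) Bool) (state : Structure σ n → ⟦ G ⟧ T)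
    {C : Vec (Fin n) j → Structure σ n → Set} →
    (∀ ds I → ∃₂ λ c J → (M ⊢ environment ds , state I ⟶[ ⟦ b ⟧ᵇ n ] c , (environment ds , state J))
      × Outcome (C ds) I c J) →
    ∀ I → ∃₂ λ c J →
      (forTuples j M ⊢ fill (vec j) (idle n) , state I ⟶[ ⟦ tuplesTime j b ⟧ᵇ n ] c ,
        (fill (vec j) (idle n) , state J))
      × Outcome (λ I → ∀ ds → C ds I) I c J
  forTuples-run zero M state body I with body [] I
  ... | c , J , r , outcome = c , J , r , outcome-map (λ { C[] [] → C[] }) outcome
  forTuples-run (suc j) {n = n} {b} M state {C} body I
    with forDown-run finite-Bool (tupleStep j M) {n} Inv step′ {false} {tuples′ I} start′
    where
    tuples′ : Structure σ n → ⟦ vec j ⊗ _ ⟧ T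
    tuples′ J = fill (vec j) (idle n) , state J
    Inv : ℕ → Bool → ⟦ vec j ⊗ _ ⟧ T → Set
    -- Counting down, the tuples checked so far are those whose first component is at least `i`; at
    -- the start there are none.
    Inv i c ts = ∃ λ J → ts ≡ tuples′ J ×
      Outcome (λ I → ∀ d → i ≤ toℕ d → ∀ ds → C (d ∷ ds) I) I c J
    start′ : Inv n false (tuples′ I)
    start′ = I , refl , unchanged λ d n≤d → contradiction (Fin.toℕ<n d) (ℕ.≤⇒≯ n≤d)
    step′ : ∀ (d : Fin n) {c ts} → Inv (suc (toℕ d)) c ts → ∃₂ λ c′ ts′ →
      (tupleStep j M c ⊢ counter d , ts ⟶[ ⟦ tuplesTime j b ⟧ᵇ n + 1 ] c′ , (counter d , ts′))
      × Inv (toℕ d) c′ ts′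
    step′ d (J , refl , outcome)
      with forTuples-run j {b = b} (on collect M) (λ K → counter d , state K) {λ ds → C (d ∷ ds)}
        (λ ds K → let c , L , r , o = body (d ∷ ds) K in c , L , on-run collect tt r , o) J
    ... | c′ , K , r , outcome′ = _ , _ , bind-run (on-run swap tt r) ret-run ,
      K , refl , outcome-map
        (λ { (above , at-d) e d≤e ds → extend above at-d e d≤e ds }) (outcome-∨ outcome outcome′)
      where
      extend : ∀ {L} → (∀ e → suc (toℕ d) ≤ toℕ e → ∀ ds → C (e ∷ ds) L) → (∀ ds → C (d ∷ ds) L) →
        ∀ e → toℕ d ≤ toℕ e → ∀ ds → C (e ∷ ds) L
      extend above at-d e d≤e ds with ℕ.m≤n⇒m<n∨m≡n d≤e
      ... | inj₁ d<e = above e d<e ds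
      ... | inj₂ d≡e with refl ← Fin.toℕ-injective d≡e = at-d ds
  ... | c , _ , r , J , refl , outcome = c , J , on-run toHead tt r ,
    outcome-map (λ { all (d ∷ ds) → all d z≤n ds }) outcome

  sweepShape : List (INF σ) → Shape
  sweepShape []      = ∅
  sweepShape (φ ∷ U) = ruleShape φ ⊗ sweepShape U

  sweep : ∀ U → Machine (• ⊗ sweepShape U) Bool
  sweep []      = ret false
  sweep (φ ∷ U) =
    bind finite-Bool (on dropThird (on swap (forTuples _ (fire φ)))) λ b →
    bind finite-Bool (on dropSecond (sweep U)) λ c →
    ret (b ∨ c)

  sweepTime : List (INF σ) → Bound
  sweepTime []      = const′ 1
  sweepTime (φ ∷ U) = tuplesTime (arity σ (head φ)) (fireTime φ) ⊕ (sweepTime U ⊕ const′ 1)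

  module _ {n : ℕ} (tail : List Cell) where

    sweep-run : ∀ U → (∀ {φ} → φ ∈ U → φ ∈ V) → ∀ (I : Structure σ n) → ∃₂ λ b J →
      (sweep U ⊢ home I tail , fill (sweepShape U) (idle n) ⟶[ ⟦ sweepTime U ⟧ᵇ n ] b ,
        (home J tail , fill (sweepShape U) (idle n)))
      × Outcome (λ I → ∀ {φ} → φ ∈ U → Stable φ I) I b J
    sweep-run [] U⊆V I = false , I , ret-run , unchanged λ ()
    sweep-run (φ ∷ U) U⊆V I
      with forTuples-run (arity σ (head φ)) {b = fireTime φ} (fire φ) (state φ tail)
        (fire-run φ tail (U⊆V (here refl))) I
    ... | b , J , r , outcome with sweep-run U (U⊆V ∘ there) J
    ... | c , K , r′ , outcome′ = b ∨ c , K ,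
      bind-run (on-run dropThird _ (on-run swap tt r)) (bind-run (on-run dropSecond _ r′) ret-run) ,
      outcome-map (λ { (at , rest) (here refl) → at ; (at , rest) (there φ∈U) → rest φ∈U })
        (outcome-∨ outcome outcome′)

  continue : Bool → ⊤ ⊎ ⊤
  continue true  = inj₁ tt
  continue false = inj₂ tt

  saturate : Machine (• ⊗ sweepShape V) ⊤
  saturate = iterate finite-⊤ (λ _ → bind finite-Bool (sweep V) λ b → ret (continue b)) tt

  -- All sweeps but the last lower the total deficit, which is at most 2 per slot; the added 1 is
  -- the last sweep, which confirms stability.
  saturateTime : Bound
  saturateTime = (const′ 1 ⊕ slotsBound σ ⊛ const′ 2) ⊛ (sweepTime V ⊕ const′ 1)

  module _ {n : ℕ} (tail : List Cell) where

    saturate-within : ∀ k (I : Structure σ n) → totalDeficit I ≤ k → ∃ λ J →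
      (saturate ⊢ home I tail , fill (sweepShape V) (idle n)
        ⟶[ suc k * ⟦ sweepTime V ⊕ const′ 1 ⟧ᵇ n ] tt ,
        (home J tail , fill (sweepShape V) (idle n)))
      × Reaches V I J × Closed V J
    saturate-within k I ≤k with sweep-run tail V id I
    ... | false , .I , r , unchanged stable = I ,
      weaken (ℕ.m≤m+n _ _) (iterate-done (bind-run r ret-run)) ,
      reaches-refl V , λ {φ} φ∈V → stable⇒fixed {φ = φ} (stable φ∈V)
    saturate-within zero    I ≤k | true , J , r , changed _ lt =
      contradiction (ℕ.<-≤-trans lt ≤k) λ ()
    saturate-within (suc k) I ≤k | true , J , r , changed reach lt
      with saturate-within k J (ℕ.≤-pred (ℕ.<-≤-trans lt ≤k))
    ... | K , r′ , reach′ , closed = K , iterate-more (bind-run r ret-run) r′ ,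
      reaches-trans V reach reach′ , closed

    saturate-run : ∀ (I : Structure σ n) → ∃ λ J →
      (saturate ⊢ home I tail , fill (sweepShape V) (idle n)
        ⟶[ ⟦ saturateTime ⟧ᵇ n ] tt , (home J tail , fill (sweepShape V) (idle n)))
      × Reaches V I J × Closed V J
    saturate-run I = saturate-within _ I (totalDeficit-bound I)

  -- Existence of a stabilizing refinement sequence

  module _ {n : ℕ} where

    -- Any changed entry would lower the deficit, by inflation; so the search for an applicable
    -- propagator only compares numbers.
    unimproved⇒fixed : ∀ {φ} {I : Structure σ n} →
      ¬ totalDeficit (propagator φ I) < totalDeficit I →
      propagator φ I ≈ˢ I
    unimproved⇒fixed {φ} {I} ¬lt P ds with I P ds ≟⁴ propagator φ I P ds
    ... | yes same   = sym same
    ... | no differs = contradiction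
      (totalDeficit-strict (propagator-inflationary φ I) P ds differs) ¬lt

    -- Greedy: any propagator that lowers the deficit is applied, and the deficit bounds the number
    -- of applications.
    stabilizing-chain : ∀ k (I : Structure σ n) → totalDeficit I ≤ k →
      ∃ λ (c : Chain (propagators V) I) →
        ∀ O → propagators V O → O (Chain.at c (Chain.len c)) ≈ˢ Chain.at c (Chain.len c)
    stabilizing-chain k I ≤k
      with Any.any? (λ φ → totalDeficit (propagator φ I) ℕ.<? totalDeficit I) V
    ... | no none = chain-stop _ , stable
      where
      stable : ∀ O → propagators V O → O I ≈ˢ I
      stable O O∈W with find O∈W
      ... | φ , φ∈V , refl = unimproved⇒fixed {φ} λ lt → none (lose φ∈V lt)
    stabilizing-chain zero I ≤k | yes some with find some
    ... | φ , φ∈V , lt = contradiction (ℕ.<-≤-trans lt ≤k) λ ()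
    stabilizing-chain (suc k) I ≤k | yes some with find some
    ... | φ , φ∈V , lt with stabilizing-chain k (propagator φ I) (ℕ.≤-pred (ℕ.<-≤-trans lt ≤k))
    ... | c , stable = chain-cons _ (propagator∈ V φ∈V)
      (propagator-inflationary φ I , λ I≈O → ℕ.<⇒≢ lt (sym (totalDeficit-cong I≈O))) c , stable

    reaches⇒limit : ∀ {I J : Structure σ n} → Reaches V I J → Closed V J → IsLim (propagators V) I J
    reaches⇒limit {I} {J} reach closed = record
      { exists = S , S-stabilizing , unique S S-stabilizing
      ; unique = unique
      }
      where
      unique : (S : RefinementSequence (propagators V) I) → RefinementSequence.Stabilizing S →
        RefinementSequence.last S ≈ˢ J
      unique S stable =
        reaches-unique V (reaches-last V S) (stabilizing⇒closed V S stable) reach closed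
      chain = stabilizing-chain _ I ℕ.≤-refl
      S = chain-sequence _ (proj₁ chain)
      S-stabilizing : RefinementSequence.Stabilizing S
      S-stabilizing rewrite chain-last (propagators V) (proj₁ chain) = proj₂ chain

-- Preparation of the tapes

-- If there are no tables, preparation scans the cell behind the input, which is
-- then represented explicitly.
padding : List Cell → List Cell
padding []       = blank
padding (_ ∷ _) = []

-- What may follow the strokes: nothing, for an empty vocabulary, or the first separator. Both end
-- the copying.
data NoTick : List Cell → Set where
  empty  : NoTick []
  marked : ∀ {rs} → NoTick (just mark ∷ rs)

module _ (F : Shape) where

  -- Creates the left sentinels. Work tapes are empty and get theirs by one move to the right; the
  -- input head has to step out to the left and come back.
  leftmost : Machine (• ⊗ F) ⊤
  leftmost = prim λ (c , cs) → tt , (c , goLeft) , fill F (nothing , goRight)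

  back : Machine (• ⊗ F) ⊤
  back = prim λ (c , cs) → tt , (c , goRight) , mapˢ F hold cs

  -- All work tapes move in step with the input head, so reading the input suffices to make every
  -- one of them idle.
  copyStep : Cell → (⊤ ⊎ ⊤) × Action × ⟦ F ⟧ Action
  copyStep (just (inj₁ stroke)) = inj₁ tt , (just tick , goRight) , fill F (just tick , goRight)
  copyStep c                    = inj₂ tt , (c , goLeft) , fill F (nothing , goLeft)

  copy : Machine (• ⊗ F) ⊤
  copy = iterate finite-⊤ (λ _ → prim λ (c , _) → copyStep c) tt

  returnStep : Cell → (⊤ ⊎ ⊤) × Action × ⟦ F ⟧ Action
  returnStep nothing  = inj₂ tt , (nothing , goRight) , fill F (nothing , goRight)
  returnStep (just x) = inj₁ tt , (just x , goLeft) , fill F (just tick , goLeft)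

  return : Machine (• ⊗ F) ⊤
  return = iterate finite-⊤ (λ _ → prim λ (c , _) → returnStep c) tt

  prepare : Machine (• ⊗ F) ⊤
  prepare =
    bind finite-⊤ leftmost λ _ →
    bind finite-⊤ back λ _ →
    bind finite-⊤ copy λ _ →
    return

  prepareTime : Bound
  prepareTime = const′ 1 ⊕ (const′ 1 ⊕ ((const′ 1 ⊕ size) ⊕ (const′ 1 ⊕ size)))

  copy-run : ∀ n ls {rs} → NoTick rs → copy ⊢ at ls (ticks n ++ rs) , fill F (tape ls nothing [])
    ⟶[ suc n ] tt ,
      (move goLeft (at (ticks n ʳ++ ls) rs) , fill F (move goLeft (tape (ticks n ʳ++ ls) nothing [])))
  copy-run zero ls empty  = iterate-done (prim-run refl (cong (_ ,_) (zipˢ-fill F act _ _)))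
  copy-run zero ls marked = iterate-done (prim-run refl (cong (_ ,_) (zipˢ-fill F act _ _)))
  copy-run (suc n) ls {rs} end = iterate-more
    (prim-run refl (cong₂ _,_ (goRight-at ls (just tick) (ticks n ++ rs)) (zipˢ-fill F act _ _)))
    (copy-run n (just tick ∷ ls) end)

  return-run : ∀ i rs rs′ → return ⊢ beforeCell i rs , fill F (beforeCell i rs′)
    ⟶[ suc i ] tt ,
      (move goRight (tape [] nothing (ticks i ʳ++ rs)) ,
       fill F (move goRight (tape [] nothing (ticks i ʳ++ rs′))))
  return-run zero    rs rs′ = iterate-done (prim-run refl (cong (_ ,_) (zipˢ-fill F act _ _)))
  return-run (suc i) rs rs′ = iterate-more
    (prim-run refl (cong₂ _,_ (goLeft-ticks i (just tick) rs)
      (trans (zipˢ-fill F act _ _) (cong (fill F) (goLeft-ticks i (just tick) rs′)))))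
    (return-run i (just tick ∷ rs) (just tick ∷ rs′))

  goLeft-at : ∀ i {rs} → NoTick rs → move goLeft (at (ticks i ++ blank) rs)
    ≡ beforeCell i (rs ++ padding rs)
  goLeft-at i empty         = goLeft-ticks i nothing []
  goLeft-at i (marked {rs}) =
    trans (goLeft-ticks i (just mark) rs)
      (cong (λ l → beforeCell i (just mark ∷ l)) (sym (List.++-identityʳ rs)))

  goRight-blank : ∀ n rs → move goRight (tape [] nothing (ticks n ʳ++ rs)) ≡ at blank (ticks n ++ rs)
  goRight-blank n rs =
    trans (cong (move goRight ∘ tape [] nothing) (ticks-ʳ++ n rs)) (goRight-at [] nothing _)

  prepare-run : ∀ n {rs} → NoTick rs → prepare ⊢ at [] (ticks n ++ rs) , fill F blankTape
    ⟶[ ⟦ prepareTime ⟧ᵇ n ] tt , (at blank (ticks n ++ rs ++ padding rs) , fill F (idle n))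
  prepare-run n {rs} end =
    bind-run (prim-run refl (cong (_ ,_) (zipˢ-fill F act _ _)))
      (bind-run (prim-run refl (cong₂ _,_ (returned (ticks n ++ rs)) (hold-all F _)))
        (bind-run (cast-end (cong₂ _,_
            (trans (cong (λ ls → move goLeft (at ls rs)) (ticks-ʳ++ n blank)) (goLeft-at n end))
            (cong (fill F) (trans (cong (λ ls → move goLeft (tape ls nothing [])) (ticks-ʳ++ n blank))
              (goLeft-ticks n nothing []))))
            (copy-run n blank end))
          (cast-end (cong₂ _,_ (goRight-blank n (rs ++ padding rs))
              (cong (fill F) (goRight-blank n blank)))
            (return-run n (rs ++ padding rs) blank))))
    where
    returned : ∀ xs → let t = move goLeft (at [] xs) in act (scanned t , goRight) t ≡ at blank xs
    returned []       = refl
    returned (x ∷ xs) = refl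

-- Conversion to Turing machines

-- The accumulator counts the tapes that follow, so that flattening a pair involves no rewriting
-- along associativity of sums.
width : Shape → ℕ → ℕ
width ∅       k = k
width •       k = suc k
width (F ⊗ G) k = width F (width G k)

flatten : ∀ F {X k} → ⟦ F ⟧ X → Vec X k → Vec X (width F k)
flatten ∅       x       vs = vs
flatten •       x       vs = x ∷ vs
flatten (F ⊗ G) (x , y) vs = flatten F x (flatten G y vs)

unflatten : ∀ F {X k} → Vec X (width F k) → ⟦ F ⟧ X × Vec X k
unflatten ∅       vs       = tt , vs
unflatten •       (v ∷ vs) = v , vs
unflatten (F ⊗ G) vs       =
  let x , vs′ = unflatten F vs
      y , vs″ = unflatten G vs′
  in (x , y) , vs″

unflatten-map : ∀ F {X Y k} (f : X → Y) x (vs : Vec X k) →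
  unflatten F (Vec.map f (flatten F x vs)) ≡ (mapˢ F f x , Vec.map f vs)
unflatten-map ∅       f x       vs = refl
unflatten-map •       f x       vs = refl
unflatten-map (F ⊗ G) f (x , y) vs
  rewrite unflatten-map F f x (flatten G y vs) | unflatten-map G f y vs = refl

zipWith-flatten : ∀ F {X Y Z k} (f : X → Y → Z) x y (vs : Vec X k) ws →
  Vec.zipWith f (flatten F x vs) (flatten F y ws) ≡ flatten F (zipˢ F f x y) (Vec.zipWith f vs ws)
zipWith-flatten ∅       f x        y        vs ws = refl
zipWith-flatten •       f x        y        vs ws = refl
zipWith-flatten (F ⊗ G) f (x , x′) (y , y′) vs ws =
  trans (zipWith-flatten F f x y (flatten G x′ vs) (flatten G y′ ws))
    (cong (flatten F (zipˢ F f x y)) (zipWith-flatten G f x′ y′ vs ws))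

flatten-fill : ∀ F {X} k (x : X) →
  flatten F (fill F x) (Vec.replicate k x) ≡ Vec.replicate (width F k) x
flatten-fill ∅       k x = refl
flatten-fill •       k x = refl
flatten-fill (F ⊗ G) k x =
  trans (cong (flatten F (fill F x)) (flatten-fill G k x)) (flatten-fill F (width G k) x)

module _ {F : Shape} (M : Machine (• ⊗ F) ⊤) where

  convert : (State M ⊎ ⊤) × ⟦ • ⊗ F ⟧ Action →
    (State M ⊎ ⊤) × Vec Action (suc (width F 0))
  convert (q , a , as) = q , a ∷ flatten F as []

  -- The last transition of `M` still writes and moves, whereas a halting machine does not act;
  -- hence the extra state in which it halts.
  turingMachine : TuringMachine Letter
  turingMachine = record
    { State       = State M ⊎ ⊤
    ; stateFinite = finite-⊎ (finite M) finite-⊤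
    ; Aux         = ⊥
    ; auxFinite   = finite-⊥
    ; workTapes   = width F 0
    ; start       = inj₁ (start M)
    ; δ           = λ
      { (inj₁ q) (c ∷ cs) → just (convert (δ M q (c , proj₁ (unflatten F cs))))
      ; (inj₂ _) _        → nothing
      }
    }

  open Run turingMachine hiding (act)

  configuration : State M ⊎ ⊤ → ⟦ • ⊗ F ⟧ T → Config
  configuration q (t , ts) = q , t ∷ flatten F ts []

  next-configuration : ∀ {q ts x as ts′} → δ M q (mapˢ (• ⊗ F) scanned ts) ≡ (x , as) →
    zipˢ (• ⊗ F) act as ts ≡ ts′ →
    next (configuration (inj₁ q) ts) ≡ just (configuration x ts′)
  next-configuration {q} {t , ts} {x} {a , as} e refl
    rewrite unflatten-map F scanned ts [] | e =
      cong (λ us → just (x , act a t ∷ us)) (zipWith-flatten F act as ts [] [])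

  halts : ∀ {q ts b ts′} → Runs M q ts b tt ts′ →
    ∃ λ k → configuration (inj₁ q) ts HaltsAfter k In configuration (inj₂ tt) ts′ × k ≤ b
  halts (exit e z)   = 1 , run (next-configuration e z) (halt refl) , s≤s z≤n
  halts (step e z r) = let k , h , k≤b = halts r in
    suc k , run (next-configuration e z) h , s≤s k≤b

  inputTape-at : ∀ w → inputTape w ≡ at [] (map (just ∘ inj₁) w)
  inputTape-at []      = refl
  inputTape-at (a ∷ w) = refl

  output-at : ∀ x ls rs {ts} → output (x , at ls rs ∷ ts) ≡ word rs
  output-at x ls []       = refl
  output-at x ls (r ∷ rs) = refl

  -- Padding is either absent or blank, and a blank ends the output word.
  word-padding : ∀ w rs → word (map (just ∘ inj₁) w ++ padding rs) ≡ w
  word-padding []      []       = refl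
  word-padding []      (_ ∷ _)  = refl
  word-padding (a ∷ w) rs       = cong (a ∷_) (word-padding w rs)

  computes : ∀ {b v w ls ts} rs → M ⊢ at [] (map (just ∘ inj₁) v) , fill F blankTape
      ⟶[ b ] tt , (at ls (map (just ∘ inj₁) w ++ padding rs) , ts) →
    ComputesWithin b v w
  computes {b} {v} {w} {ls} {ts} rs r with halts r
  ... | k , h , k≤b = k , end , subst (_HaltsAfter k In end) start≡ h ,
    trans (output-at (inj₂ tt) ls (map (just ∘ inj₁) w ++ padding rs) {flatten F ts []})
      (word-padding w rs) , k≤b
    where
    end = configuration (inj₂ tt) (at ls (map (just ∘ inj₁) w ++ padding rs) , ts)
    start≡ : configuration (inj₁ (start M)) (at [] (map (just ∘ inj₁) v) , fill F blankTape)
      ≡ initial v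
    start≡ = cong₂ (λ t ts → inj₁ (start M) , t ∷ ts) (sym (inputTape-at v))
      (flatten-fill F 0 blankTape)

-- Encodings as tape contents, and the final machine

module _ {σ : Vocabulary} {n : ℕ} (I : Structure σ n) where

  content : List (Slot σ n) → List Cell
  content xs = map just (map (inj₁ ∘ letter I) xs)

  tables : List Cell
  tables = content (concatMap (tableSlots σ n) (allFin _))

  tables-noTick : NoTick tables
  tables-noTick = noTick id
    where
    noTick : ∀ {N} (g : Fin N → Symbol σ) →
      NoTick (content (concatMap (tableSlots σ n) (tabulate g)))
    noTick {zero}  g = empty
    noTick {suc N} g = marked

  content-slots : content (slots σ n) ≡ ticks n ++ tables
  content-slots = begin
    map just (map (inj₁ ∘ letter I) (List.replicate n unit ++ ts))
      ≡⟨ cong (map just) (List.map-++ (inj₁ ∘ letter I) (List.replicate n unit) ts) ⟩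
    map just (map (inj₁ ∘ letter I) (List.replicate n unit) ++ map (inj₁ ∘ letter I) ts)
      ≡⟨ List.map-++ just (map (inj₁ ∘ letter I) (List.replicate n unit)) _ ⟩
    map just (map (inj₁ ∘ letter I) (List.replicate n unit)) ++ tables
      ≡⟨ cong (λ l → map just l ++ tables) (List.map-replicate (inj₁ ∘ letter I) n unit) ⟩
    map just (List.replicate n tick) ++ tables
      ≡⟨ cong (_++ tables) (List.map-replicate just n tick) ⟩
    ticks n ++ tables ∎
    where
    open ≡-Reasoning
    ts = concatMap (tableSlots σ n) (allFin _)

  content-encode : content (slots σ n) ≡ map (just ∘ inj₁) (encode I)
  content-encode = begin
    map just (map (inj₁ ∘ letter I) (slots σ n)) ≡⟨ List.map-∘ (slots σ n) ⟨
    map (just ∘ inj₁ ∘ letter I) (slots σ n)     ≡⟨ List.map-∘ (slots σ n) ⟩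
    map (just ∘ inj₁) (map (letter I) (slots σ n)) ≡⟨ cong (map (just ∘ inj₁)) (encode-slots I) ⟨
    map (just ∘ inj₁) (encode I) ∎
    where open ≡-Reasoning

theorem4p4 : (σ : Vocabulary) (V : List (INF σ)) →
    PolynomialTimeComputable σ (λ I L → IsLim (propagators V) I L)
theorem4p4 σ V = turingMachine M , toPolynomial bound , λ I →
  let J , r , reach , closed = saturate-run V (padding (tables I)) I in
  J , reaches⇒limit V reach closed , correct I J r
  where
  F = sweepShape V V
  M = bind finite-⊤ (prepare F) λ _ → saturate V
  bound = prepareTime F ⊕ saturateTime V

  correct : ∀ {n} (I J : Structure σ n) →
    saturate V ⊢ home I (padding (tables I)) , fill F (idle n)
      ⟶[ ⟦ saturateTime V ⟧ᵇ n ] tt , (home J (padding (tables I)) , fill F (idle n)) →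
    Run.ComputesWithin (turingMachine M) (evalPoly (toPolynomial bound) n) (encode I) (encode J)
  correct {n} I J r rewrite evalPoly-toPolynomial bound n = computes M (tables I)
    (cast-end (cong (λ l → at blank (l ++ padding (tables I)) , fill F (idle n)) (content-encode J))
      (bind-run (subst₂ (λ l l′ → prepare F ⊢ at [] l , fill F blankTape
          ⟶[ ⟦ prepareTime F ⟧ᵇ n ] tt , (at blank l′ , fill F (idle n)))
        (trans (sym (content-slots I)) (content-encode I))
        (trans (sym (List.++-assoc (ticks n) _ _))
          (cong (_++ padding (tables I)) (sym (content-slots I))))
        (prepare-run F n (tables-noTick I))) r))
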